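{- For $m\ge2$, let $Q_{4m}=\langle a,b\mid a^{2m}=e,\ b^2=a^m,\ b^{ -1}ab=a^{ -1}\rangle$ be the generalized quaternion group of order $4m$. In the directed Cayley graph $\Gamma(Q_{4m},\{a,b\})$ the Lin--Lu--Yau Ricci curvatures of the arcs $(e,a)$ and $(e,b)$ are $$\kappa(e,a)=\begin{cases}0,& m=2,\\ -\tfrac12,& m=3,\\ -1,& m=4,\\ -\tfrac32,& m=5,\\ -2,& m\ge6,\end{cases}\qquad \kappa(e,b)=\begin{cases}0,& m=2,\\ -\tfrac12,& m=3,\\ -1,& m\ge4.\end{cases}$$
   Context: For a group $G$ with identity $e$ and a finite set $S\subseteq G\setminus\{e\}$, the directed Cayley graph $\Gamma(G,S)$ has vertex set $G$ and arcs $(g,gs)$ for $g\in G$, $s\in S$. In a simple directed graph $(V,\mathcal A)$, $N^{\rm out}(x)=\{v\in V:(x,v)\in\mathcal A\}$, $d^{\rm out}_x=|N^{\rm out}(x)|$, and $d(x,y)$ is the length of a shortest directed path from $x$ to $y$. For $\alpha\in[0,1]$, the $\alpha$-lazy random walk measure at $x$ is $\mu^\alpha_x(x)=\alpha$, $\mu^\alpha_x(v)=\frac{1-\alpha}{d^{\rm out}_x}$ if $(x,v)\in\mathcal A$, and $\mu_x^\alpha(v)=0$ otherwise. For probability measures $\mu,\nu$ on $V$, $W(\mu,\nu)=\inf_A\sum_{u,v\in V}A(u,v)d(u,v)$, the infimum over couplings $A:V\times V\to[0,1]$ with $\sum_{v}A(u,v)=\mu(u)$ for all $u$ and $\sum_uA(u,v)=\nu(v)$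 for all $v$. For distinct $x,y$, $\kappa_\alpha(x,y)=1-\frac{W(\mu_x^\alpha,\mu_y^\alpha)}{d(x,y)}$, and the Lin--Lu--Yau Ricci curvature is $\kappa(x,y)=\lim_{\alpha\to1^- }\frac{\kappa_\alpha(x,y)}{1-\alpha}$. -}

module Defs where

open import Level using (Level; 0ℓ; suc; _⊔_)
open import Algebra.Apartness.Bundles using (HeytingField)
open import Algebra.Bundles using (CommutativeRing; Group)
import Algebra.Definitions.RawMonoid as RawMonoidDefinitions
import Algebra.Properties.Group as GroupProperties
open import Data.Fin using (Fin)
import Data.Fin.Properties as Fin
open import Data.List using (List; filter; length; allFin)
open import Data.List.Membership.Propositional using (lose)
open import Data.List.Membership.Propositional.Properties using (∈-allFin)
open import Data.List.Properties using (filter-some)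
open import Data.List.Relation.Unary.All as All using (All)
open import Data.List.Relation.Unary.Any as Any using (Any)
open import Data.Nat as ℕ using (ℕ; NonZero)
open import Data.Product using (Σ-syntax; ∃-syntax; _×_; _,_; proj₁; proj₂)
open import Data.Sum using (_⊎_; inj₁; inj₂)
open import Function.Bundles using (Inverse)
import Function.Construct.Symmetry as Symmetry
open import Function.Properties.Inverse using (Inverse⇒Injection)
open import Relation.Binary.Bundles using (Setoid)
open import Relation.Binary.Core using (Rel)
open import Relation.Binary.Definitions using (Decidable; _Respects₂_)
import Relation.Binary.PropositionalEquality as ≡
open import Relation.Binary.Structures using (IsStrictPartialOrder)
open import Relation.Nullary using (¬_; yes; no; contradiction)
open import Relation.Nullary.Decidable using (via-injection)

-- ℝ is axiomatised, as usual, as a Cauchy-complete Archimedean ordered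
-- field; classically these axioms determine it up to isomorphism.  No
-- decidability of the order is assumed, so that _≤_ is the negation of
-- the reversed strict order.

record RealNumbers (c ℓ₁ ℓ₂ ℓ₃ : Level) : Set (suc (c ⊔ ℓ₁ ⊔ ℓ₂ ⊔ ℓ₃)) where
  infix  4 _<_ _≤_
  infixl 7 _/ℕ_

  field
    heytingField : HeytingField c ℓ₁ ℓ₂

  open HeytingField heytingField public

  commutativeRing : CommutativeRing c ℓ₁
  commutativeRing = record { isCommutativeRing = isCommutativeRing }

  open CommutativeRing commutativeRing public using (+-rawMonoid)
  open RawMonoidDefinitions +-rawMonoid public using (sum) renaming (_×_ to _·_)

  fromℕ : ℕ → Carrier
  fromℕ n = n · 1#

  field
    _<_                  : Rel Carrier ℓ₃
    isStrictPartialOrder : IsStrictPartialOrder _≈_ _<_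
    <⇒#                  : ∀ {x y} → x < y → x # y
    #⇒<⊎>                : ∀ {x y} → x # y → x < y ⊎ y < x
    0<1                  : 0# < 1#
    +-monoʳ-<            : ∀ x {y z} → y < z → x + y < x + z
    *-pos                : ∀ {x y} → 0# < x → 0# < y → 0# < x * y
    archimedean          : ∀ x → ∃[ n ] x < fromℕ n
    complete             : ∀ (s : ℕ → Carrier) →
      (∀ ε → 0# < ε → ∃[ N ] ∀ i j → N ℕ.≤ i → N ℕ.≤ j → s i < s j + ε) →
      ∃[ l ] ∀ ε → 0# < ε → ∃[ N ] ∀ i → N ℕ.≤ i → s i < l + ε × l < s i + ε

  open IsStrictPartialOrder isStrictPartialOrder public
    using (<-respʳ-≈) renaming (trans to <-trans)

  _≤_ : Rel Carrier ℓ₃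
  x ≤ y = ¬ (y < x)

  -- 1/ p is the inverse of x - y, not of x.
  1/_ : ∀ {x y} → x # y → Carrier
  1/ p = proj₁ (#⇒invertible p)

  0<fromℕ : ∀ n → 0# < fromℕ (ℕ.suc n)
  0<fromℕ ℕ.zero    = <-respʳ-≈ (sym (+-identityʳ 1#)) 0<1
  0<fromℕ (ℕ.suc n) = <-trans (0<fromℕ 0) (+-monoʳ-< 1# (0<fromℕ n))

  _/ℕ_ : Carrier → (n : ℕ) .{{_ : NonZero n}} → Carrier
  x /ℕ ℕ.suc n = x * 1/ (#-sym (<⇒# (0<fromℕ n)))

  record IsInfimum {p} (P : Carrier → Set p) (w : Carrier) :
                   Set (c ⊔ ℓ₃ ⊔ p) where
    field
      lowerBound : ∀ t → P t → w ≤ t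
      greatest   : ∀ l → (∀ t → P t → l ≤ t) → l ≤ w

-- Vertices form a setoid because the elements of a presented group do.

record FiniteDigraph (v ℓ r : Level) : Set (suc (v ⊔ ℓ ⊔ r)) where
  field
    vertices : Setoid v ℓ

  open Setoid vertices public renaming (Carrier to V)

  field
    order       : ℕ
    enumeration : Inverse (≡.setoid (Fin order)) vertices
    Arc         : Rel V r
    Arc-resp-≈  : Arc Respects₂ _≈_
    arc?        : Decidable Arc
    loopless    : ∀ {x} → ¬ Arc x x

  open Inverse enumeration using (from; inverseˡ) renaming (to to vertex) public

  _≟_ : Decidable _≈_
  _≟_ = via-injection (Inverse⇒Injection (Symmetry.inverse enumeration)) Fin._≟_

  outdegree : V → ℕ
  outdegree x = length (filter (λ i → arc? x (vertex i)) (allFin order))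

  arc⇒outdegree≢0 : ∀ {x y} → Arc x y → NonZero (outdegree x)
  arc⇒outdegree≢0 {x} {y} p = ℕ.>-nonZero
    (filter-some (λ i → arc? x (vertex i))
      (lose (∈-allFin (from y))
        (proj₁ Arc-resp-≈ (sym (inverseˡ ≡.refl)) p)))

  data Walk : ℕ → V → V → Set (v ⊔ ℓ ⊔ r) where
    stop : ∀ {x y} → x ≈ y → Walk 0 x y
    step : ∀ {n x y z} → Arc x y → Walk n y z → Walk (ℕ.suc n) x z

  -- Exists exactly when the graph is strongly connected, and is then
  -- unique.
  record Distance : Set (v ⊔ ℓ ⊔ r) where
    field
      d        : V → V → ℕ
      attained : ∀ x y → Walk (d x y) x y
      shortest : ∀ {n x y} → Walk n x y → d x y ℕ.≤ n

    d≢0 : ∀ {x y} → ¬ x ≈ y → NonZero (d x y)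
    d≢0 {x} {y} x≉y with d x y | attained x y
    ... | ℕ.zero  | stop x≈y = contradiction x≈y x≉y
    ... | ℕ.suc _ | _        = _

module Curvature {c ℓ₁ ℓ₂ ℓ₃ v ℓ r : Level}
                 (ℝ : RealNumbers c ℓ₁ ℓ₂ ℓ₃) (Γ : FiniteDigraph v ℓ r) where

  open RealNumbers ℝ using (_+_; _*_; _-_; 0#; 1#; _<_; _≤_; _/ℕ_; 1/_; <⇒#;
                            #-sym; sum; fromℕ; IsInfimum)
    renaming (Carrier to R; _≈_ to _≈ᴿ_)
  open FiniteDigraph Γ

  lazyWalk : R → V → V → R
  lazyWalk α x u with x ≟ u | arc? x u
  ... | yes _ | _     = α
  ... | no  _ | yes p = ((1# - α) /ℕ outdegree x) {{arc⇒outdegree≢0 p}}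
  ... | no  _ | no  _ = 0#

  ∑ᵛ : (V → R) → R
  ∑ᵛ f = sum (λ i → f (vertex i))

  record Coupling (μ ν : V → R) : Set (c ⊔ ℓ₁ ⊔ ℓ₃ ⊔ v ⊔ ℓ) where
    field
      A         : V → V → R
      A-cong    : ∀ {u u′ w w′} → u ≈ u′ → w ≈ w′ → A u w ≈ᴿ A u′ w′
      A≥0       : ∀ u w → 0# ≤ A u w
      A≤1       : ∀ u w → A u w ≤ 1#
      marginalˡ : ∀ u → ∑ᵛ (λ w → A u w) ≈ᴿ μ u
      marginalʳ : ∀ w → ∑ᵛ (λ u → A u w) ≈ᴿ ν w

  module _ (δ : Distance) where
    open Distance δ

    cost : ∀ {μ ν} → Coupling μ ν → R
    cost π = ∑ᵛ λ u → ∑ᵛ λ w → Coupling.A π u w * fromℕ (d u w)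

    IsWasserstein : (μ ν : V → R) → R → Set (c ⊔ ℓ₁ ⊔ ℓ₃ ⊔ v ⊔ ℓ)
    IsWasserstein μ ν = IsInfimum λ t → Σ[ π ∈ Coupling μ ν ] t ≈ᴿ cost π

    IsLazyCurvature : ∀ {x y} → ¬ x ≈ y → (α κα : R) → Set (c ⊔ ℓ₁ ⊔ ℓ₃ ⊔ v ⊔ ℓ)
    IsLazyCurvature {x} {y} x≉y α κα =
      ∃[ w ] IsWasserstein (lazyWalk α x) (lazyWalk α y) w ×
             κα ≈ᴿ 1# - (w /ℕ d x y) {{d≢0 x≉y}}

    -- (x , y) has Lin–Lu–Yau curvature κ:
    -- κ is the limit of κ_α(x,y) / (1 - α) as α → 1 from below.
    IsLimitCurvature : ∀ {x y} → ¬ x ≈ y → R → Set (c ⊔ ℓ₁ ⊔ ℓ₃ ⊔ v ⊔ ℓ)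
    IsLimitCurvature x≉y κ =
      ∀ ε → 0# < ε → ∃[ η ] 0# < η ×
        (∀ α → 0# ≤ α → 1# - η < α → (α<1 : α < 1#) →
          ∃[ κα ] IsLazyCurvature x≉y α κα ×
            (let q = κα * 1/ (#-sym (<⇒# α<1)) in κ - ε < q × q < κ + ε))

  HasCurvature : V → V → R → Set (c ⊔ ℓ₁ ⊔ ℓ₃ ⊔ v ⊔ ℓ ⊔ r)
  HasCurvature x y κ =
    Σ[ δ ∈ Distance ] Σ[ x≉y ∈ ¬ x ≈ y ] IsLimitCurvature δ x≉y κ

open Curvature public using (HasCurvature)

-- Used only to decide equality and to sum over the group; neither depends
-- on the choice of enumeration.
Enumeration : ∀ {c ℓ} → Group c ℓ → ℕ → Set (c ⊔ ℓ)
Enumeration G n = Inverse (≡.setoid (Fin n)) (Group.setoid G)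

-- The connection set S is given by a list; repetitions are immaterial.
Cayley : ∀ {c ℓ n} (G : Group c ℓ) → Enumeration G n →
         (S : List (Group.Carrier G)) → All (λ s → ¬ Group._≈_ G s (Group.ε G)) S →
         FiniteDigraph c ℓ (c ⊔ ℓ)
Cayley {n = n} G enum S ε∉S = record
  { vertices    = setoid
  ; order       = n
  ; enumeration = enum
  ; Arc         = λ g h → Any (λ s → h ≈ g ∙ s) S
  ; Arc-resp-≈  = (λ h≈h′ → Any.map (trans (sym h≈h′)))
                , (λ g≈g′ → Any.map (λ h≈gs → trans h≈gs (∙-congʳ g≈g′)))
  ; arc?        = λ g h → Any.any? (λ s → h ≟ᴳ (g ∙ s)) S
  ; loopless    = λ {x} x→x →
      All.lookupAny ε∉S x→x .proj₁
        (sym (∙-cancelˡ x ε _ (trans (identityʳ x) (All.lookupAny ε∉S x→x .proj₂))))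
  }
  where
  open Group G
  open GroupProperties G using (∙-cancelˡ)
  _≟ᴳ_ : Decidable _≈_
  _≟ᴳ_ = via-injection (Inverse⇒Injection (Symmetry.inverse enum)) Fin._≟_

infixl 7 _∙_
infix  8 _⁻¹
infixr 9 _^_

data Term (X : Set) : Set where
  gen : X → Term X
  e   : Term X
  _∙_ : Term X → Term X → Term X
  _⁻¹ : Term X → Term X

_^_ : ∀ {X} → Term X → ℕ → Term X
t ^ ℕ.zero  = e
t ^ ℕ.suc n = t ∙ t ^ n

-- The least group congruence on terms containing the relations Rel.
data Derivable {X : Set} (Rel : Term X → Term X → Set) : Term X → Term X → Set where
  relation  : ∀ {s t} → Rel s t → Derivable Rel s t
  refl      : ∀ {t} → Derivable Rel t t
  sym       : ∀ {s t} → Derivable Rel s t → Derivable Rel t s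
  trans     : ∀ {s t u} → Derivable Rel s t → Derivable Rel t u → Derivable Rel s u
  ∙-cong    : ∀ {s s′ t t′} → Derivable Rel s s′ → Derivable Rel t t′ →
              Derivable Rel (s ∙ t) (s′ ∙ t′)
  ⁻¹-cong   : ∀ {s t} → Derivable Rel s t → Derivable Rel (s ⁻¹) (t ⁻¹)
  assoc     : ∀ s t u → Derivable Rel ((s ∙ t) ∙ u) (s ∙ (t ∙ u))
  identityˡ : ∀ t → Derivable Rel (e ∙ t) t
  identityʳ : ∀ t → Derivable Rel (t ∙ e) t
  inverseˡ  : ∀ t → Derivable Rel (t ⁻¹ ∙ t) e
  inverseʳ  : ∀ t → Derivable Rel (t ∙ t ⁻¹) e

⟨_∣_⟩ : (X : Set) → (Term X → Term X → Set) → Group 0ℓ 0ℓ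
⟨ X ∣ Rel ⟩ = record
  { Carrier = Term X
  ; _≈_     = Derivable Rel
  ; _∙_     = _∙_
  ; ε       = e
  ; _⁻¹     = _⁻¹
  ; isGroup = record
    { isMonoid = record
      { isSemigroup = record
        { isMagma = record
          { isEquivalence = record { refl = refl ; sym = sym ; trans = trans }
          ; ∙-cong        = ∙-cong
          }
        ; assoc = assoc
        }
      ; identity = identityˡ , identityʳ
      }
    ; inverse = inverseˡ , inverseʳ
    ; ⁻¹-cong = ⁻¹-cong
    }
  }

data Generator : Set where
  𝕒 𝕓 : Generator

a b : Term Generator
a = gen 𝕒
b = gen 𝕓

data QuaternionRelation (m : ℕ) : Term Generator → Term Generator → Set where
  a²ᵐ≈e     : QuaternionRelation m (a ^ (2 ℕ.* m)) e
  b²≈aᵐ     : QuaternionRelation m (b ^ 2) (a ^ m)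
  b⁻¹ab≈a⁻¹ : QuaternionRelation m (b ⁻¹ ∙ a ∙ b) (a ⁻¹)

-- Q₄ m is Q_{4m}.
Q₄ : ℕ → Group 0ℓ 0ℓ
Q₄ m = ⟨ Generator ∣ QuaternionRelation m ⟩

-- Only the values at m ≥ 2 are meaningful.

module _ {c ℓ₁ ℓ₂ ℓ₃ : Level} (ℝ : RealNumbers c ℓ₁ ℓ₂ ℓ₃) where
  open RealNumbers ℝ using (Carrier; -_; 0#; 1#; fromℕ; _/ℕ_)

  curvature-ea : ℕ → Carrier
  curvature-ea 2 = 0#
  curvature-ea 3 = - (fromℕ 1 /ℕ 2)
  curvature-ea 4 = - fromℕ 1
  curvature-ea 5 = - (fromℕ 3 /ℕ 2)
  curvature-ea _ = - fromℕ 2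

  curvature-eb : ℕ → Carrier
  curvature-eb 2 = 0#
  curvature-eb 3 = - (fromℕ 1 /ℕ 2)
  curvature-eb _ = - fromℕ 1

{-# OPTIONS --safe #-}
module Submission where

-- With β = (1 - α)/2, the distance W(μ_e, μ_x) for x ∈ {a, b} equals
-- α + cβ for every α, where c - 1 = d(y, x²) and y is the other generator:
-- moving mass α from e to x, β from x to xy and β from y to x² is optimal,
-- because φ = min(3 + d(e,·), 4 + d(x,·), 6 - c + d(y,·)) is 1-Lipschitz and
-- takes the values 3, 4, 6 - c at e, x, y and 4, 5, 5 at x, xy, x².  Hence
-- κ = 1 - c/2, with c = min(m, 6) for x = a and c = min(m, 4) for x = b.
--
-- Since c ≤ 6, the required lower bounds on distances only concern words of
-- length at most 4, whose values a^(j + εm) bˡ are enumerated uniformly in m.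

open import Defs using (RealNumbers; FiniteDigraph; module Curvature)
open import Level using (Level; _⊔_)
open import Algebra.Bundles using (CommutativeRing; Group)
import Algebra.Properties.Ring as RingProperties
import Algebra.Properties.Semiring.Mult as SemiringMult
import Algebra.Properties.Semiring.Sum as SemiringSum
import Algebra.Solver.Ring.NaturalCoefficients.Default as SemiringSolver
open import Data.Bool using (Bool; true; false; not; _xor_; if_then_else_)
import Data.Bool.Properties as Bool
open import Data.Fin as Fin using (Fin)
import Data.Fin.Properties as Fin
open import Data.Integer as ℤ using (ℤ; +_; -[1+_]; 0ℤ; 1ℤ; -1ℤ; ∣_∣)
open import Data.Integer.Divisibility.Signed
  using (divides; ∣⇒∣ᵤ; ∣m∣n⇒∣m+n; ∣m⇒∣-m) renaming (_∣_ to _∣ℤ_)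
import Data.Integer.DivMod as ℤ
import Data.Integer.Properties as ℤ
open import Data.Integer.Tactic.RingSolver using (solve-∀)
open import Data.List using (List; []; _∷_; filter; length; allFin; foldl)
open import Data.List.Membership.Propositional using (_∈_)
open import Data.List.Membership.Propositional.Properties using (∈-allFin; ∈-filter⁺; ∈-filter⁻)
open import Data.List.Membership.Propositional.Properties.WithK using (unique∧set⇒bag)
open import Data.List.Relation.Binary.BagAndSetEquality using (∼bag⇒↭)
open import Data.List.Relation.Binary.Permutation.Propositional.Properties using (↭-length)
open import Data.List.Relation.Unary.All using (All; []; _∷_)
open import Data.List.Relation.Unary.AllPairs using ([]; _∷_)
open import Data.List.Relation.Unary.Any using (here; there)
open import Data.List.Relation.Unary.Unique.Propositional.Properties using (allFin⁺; filter⁺)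
open import Data.Nat as ℕ using (ℕ; zero; suc; NonZero; _⊓_; _∸_)
import Data.Nat.Divisibility as ℕ
import Data.Nat.Properties as ℕ
open import Data.Product using (Σ-syntax; ∃-syntax; _×_; _,_; proj₁; proj₂)
open import Data.Product.Function.NonDependent.Propositional using (_×-↔_)
import Data.Sum as Sum
open import Data.Sum using (_⊎_; inj₁; inj₂; [_,_]′)
open import Function using (_∘_; mk⇔)
open import Function.Bundles using (Inverse)
import Function.Construct.Composition as Composition
import Function.Construct.Identity as Identity
open import Relation.Binary.PropositionalEquality as ≡ using (_≡_; _≢_)
import Relation.Binary.Reasoning.Setoid as SetoidReasoning
open import Relation.Binary.Structures using (IsStrictPartialOrder)
open import Relation.Nullary using (¬_; Dec; yes; no; contradiction)
open import Relation.Nullary.Decidable using (True; toWitness; map′; _×-dec_; _⊎-dec_; ¬?)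
open import Relation.Unary using (Decidable)

-- The constants in φ come from complementary slackness: along the three moves the potential must
-- rise by exactly 1, 1 and c - 1. With 5 as the common value at xy and x², this forces 4 at x, 3 at
-- e and 6 - c at y. Starting at 3 keeps 6 - c a natural number up to c = 6, so φ is ℕ-valued, its
-- Lipschitz estimates are inequalities in ℕ, and real numbers enter only as weights. A minimum of
-- three such cones is the largest 1-Lipschitz function bounded by 3, 4, 6 - c at e, x, y.
--
-- Two obstacles shape the rest. The order on the reals is not decidable and `_≤_` is a negation, so
-- inequalities are moved and cancelled rather than decided by cases. Group elements are terms
-- modulo derivability, so bounding a distance from below means proving terms not derivably equal.
-- That takes invariants of terms, and their completeness is needed as well, to enumerate the group
-- and to identify endpoints of walks.

least : ∀ {p} {P : ℕ → Set p} → Decidable P → ∀ n → P n →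
        ∃[ k ] P k × (∀ {j} → P j → k ℕ.≤ j)
least P? n Pn with P? 0
least P? n       Pn | yes P0 = 0 , P0 , λ _ → ℕ.z≤n
least P? zero    P0 | no ¬P0 = contradiction P0 ¬P0
least P? (suc n) Pn | no ¬P0 with least (P? ∘ suc) n Pn
... | k , Pk , min = suc k , Pk , λ
  { {zero}  P0 → contradiction P0 ¬P0
  ; {suc j} Pj → ℕ.s≤s (min Pj) }

-- Order and arithmetic of the reals without decidability.

module Reals {c ℓ₁ ℓ₂ ℓ₃} (ℝ : RealNumbers c ℓ₁ ℓ₂ ℓ₃) where
  open RealNumbers ℝ
  open CommutativeRing commutativeRing using (ring; semiring; commutativeSemiring)
  open SetoidReasoning setoid
  open SemiringSolver commutativeSemiring using (solve; _:=_; _:+_; _:*_; con)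
  open SemiringSum semiring using (sum-remove; sum-cong-≋; sum-replicate-zero)
  open RingProperties ring using (x≈z//y; -‿+-comm)
  open SemiringMult semiring using (×-homo-+)
  private module < = IsStrictPartialOrder isStrictPartialOrder

  ≤-reflexive : ∀ {x y} → x ≈ y → x ≤ y
  ≤-reflexive x≈y = <.irrefl (sym x≈y)

  <⇒≤ : ∀ {x y} → x < y → x ≤ y
  <⇒≤ = <.asym

  -- An apartness orients to one of two strict inequalities, and the unwanted orientation yields the
  -- other alternative by transitivity. This replaces trichotomy and is what makes the negatively
  -- defined `_≤_` transitive.
  <-cotrans : ∀ {x y} → x < y → ∀ z → x < z ⊎ z < y
  <-cotrans x<y z with #-cotrans (<⇒# x<y) z
  ... | inj₁ x#z = [ inj₁ , (λ z<x → inj₂ (<-trans z<x x<y)) ]′ (#⇒<⊎> x#z)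
  ... | inj₂ z#y = [ inj₂ , (λ y<z → inj₁ (<-trans x<y y<z)) ]′ (#⇒<⊎> z#y)

  ≤-trans : ∀ {x y z} → x ≤ y → y ≤ z → x ≤ z
  ≤-trans {y = y} x≤y y≤z z<x = [ y≤z , x≤y ]′ (<-cotrans z<x y)

  ≤-resp : ∀ {x x′ y y′} → x ≈ x′ → y ≈ y′ → x ≤ y → x′ ≤ y′
  ≤-resp x≈x′ y≈y′ x≤y y′<x′ = x≤y (<-respʳ-≈ (sym x≈x′) (<.<-respˡ-≈ (sym y≈y′) y′<x′))

  +-cancelˡ-< : ∀ x {y z} → x + y < x + z → y < z
  +-cancelˡ-< x {y} {z} x+y<x+z =
    <-respʳ-≈ (cancel z) (<.<-respˡ-≈ (cancel y) (+-monoʳ-< (- x) x+y<x+z))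
    where
    cancel : ∀ t → - x + (x + t) ≈ t
    cancel t = begin
      - x + (x + t)  ≈⟨ +-assoc (- x) x t ⟨
      - x + x + t    ≈⟨ +-congʳ (-‿inverseˡ x) ⟩
      0# + t         ≈⟨ +-identityˡ t ⟩
      t              ∎

  +-monoʳ-≤ : ∀ x {y z} → y ≤ z → x + y ≤ x + z
  +-monoʳ-≤ x y≤z x+z<x+y = y≤z (+-cancelˡ-< x x+z<x+y)

  +-mono-≤ : ∀ {x y u v} → x ≤ y → u ≤ v → x + u ≤ y + v
  +-mono-≤ {x} {y} {u} {v} x≤y u≤v =
    ≤-trans (+-monoʳ-≤ x u≤v) (≤-resp (+-comm v x) (+-comm v y) (+-monoʳ-≤ v x≤y))

  +-cancelˡ-≤ : ∀ x {y z} → x + y ≤ x + z → y ≤ z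
  +-cancelˡ-≤ x x+y≤x+z z<y = x+y≤x+z (+-monoʳ-< x z<y)

  x≤x+y : ∀ x {y} → 0# ≤ y → x ≤ x + y
  x≤x+y x 0≤y = ≤-resp (+-identityʳ x) refl (+-monoʳ-≤ x 0≤y)

  sum-mono-≤ : ∀ {n} {f g : Fin n → Carrier} → (∀ i → f i ≤ g i) → sum f ≤ sum g
  sum-mono-≤ {zero}  f≤g = ≤-reflexive refl
  sum-mono-≤ {suc n} f≤g = +-mono-≤ (f≤g Fin.zero) (sum-mono-≤ (f≤g ∘ Fin.suc))

  fromℕ-+ : ∀ m n → fromℕ (m ℕ.+ n) ≈ fromℕ m + fromℕ n
  fromℕ-+ m n = ×-homo-+ 1# m n

  *-monoʳ-fromℕ : ∀ {x m n} → 0# ≤ x → m ℕ.≤ n → x * fromℕ m ≤ x * fromℕ n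
  *-monoʳ-fromℕ {x} {m} {n} 0≤x m≤n with ℕ.m≤n⇒∃[o]m+o≡n m≤n
  ... | o , ≡.refl = ≤-resp refl
    (trans (sym (distribˡ x (fromℕ m) (fromℕ o))) (*-congˡ (sym (fromℕ-+ m o))))
    (x≤x+y (x * fromℕ m) (0≤x*fromℕ o))
    where
    0≤x*fromℕ : ∀ k → 0# ≤ x * fromℕ k
    0≤x*fromℕ zero    = ≤-reflexive (sym (zeroʳ x))
    0≤x*fromℕ (suc k) = ≤-resp (+-identityʳ 0#)
      (trans (+-congʳ (sym (*-identityʳ x))) (sym (distribˡ x 1# (fromℕ k))))
      (+-mono-≤ 0≤x (0≤x*fromℕ k))

  *-1/ : ∀ {x y} (x#y : x # y) → (x - y) * 1/ x#y ≈ 1#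
  *-1/ x#y = proj₂ (proj₂ (#⇒invertible x#y))

  x-0≈x : ∀ x → x - 0# ≈ x
  x-0≈x x = sym (x≈z//y x 0# x (+-identityʳ x))

  /ℕ-* : ∀ x n → (x /ℕ suc n) * fromℕ (suc n) ≈ x
  /ℕ-* x n = begin
    x * i * fromℕ (suc n)           ≈⟨ *-assoc x i _ ⟩
    x * (i * fromℕ (suc n))         ≈⟨ *-congˡ (*-comm i _) ⟩
    x * (fromℕ (suc n) * i)         ≈⟨ *-congˡ (*-congʳ (sym (x-0≈x _))) ⟩
    x * ((fromℕ (suc n) - 0#) * i)  ≈⟨ *-congˡ (*-1/ _) ⟩
    x * 1#                          ≈⟨ *-identityʳ x ⟩
    x                               ∎
    where i = 1/ (#-sym (<⇒# (0<fromℕ n)))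

  /ℕ-congʳ : ∀ x {m n} .{{_ : NonZero m}} .{{_ : NonZero n}} → m ≡ n → x /ℕ m ≈ x /ℕ n
  /ℕ-congʳ x ≡.refl = refl

  x/2+x/2≈x : ∀ x → x /ℕ 2 + x /ℕ 2 ≈ x
  x/2+x/2≈x x = begin
    h + h                ≈⟨ solve 2 (λ h o → h :+ h := h :+ (h :+ con 0)) refl h 1# ⟩
    h + (h + 0#)         ≈⟨ +-cong (*-identityʳ h) (+-cong (*-identityʳ h) (zeroʳ h)) ⟨
    h * 1# + (h * 1# + h * 0#)  ≈⟨ +-congˡ (distribˡ h 1# 0#) ⟨
    h * 1# + h * (1# + 0#)  ≈⟨ distribˡ h 1# _ ⟨
    h * fromℕ 2          ≈⟨ /ℕ-* x 1 ⟩
    x                    ∎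
    where h = x /ℕ 2

  x/1≈x : ∀ x → x /ℕ 1 ≈ x
  x/1≈x x = begin
    x /ℕ 1            ≈⟨ *-identityʳ _ ⟨
    x /ℕ 1 * 1#       ≈⟨ *-congˡ (+-identityʳ 1#) ⟨
    x /ℕ 1 * fromℕ 1  ≈⟨ /ℕ-* x 0 ⟩
    x                 ∎

  n+n≈2n : ∀ n → fromℕ n + fromℕ n ≈ fromℕ (n ℕ.+ n)
  n+n≈2n n = sym (fromℕ-+ n n)

  0+0+2≈2 : 0# + 0# + fromℕ 2 ≈ fromℕ 2
  0+0+2≈2 = trans (+-congʳ (+-identityˡ 0#)) (+-identityˡ (fromℕ 2))

  -- Every nonzero curvature is -j/2 with c = j + 2. The doubled form 2κ + c = 2 treats
  -- half-integral and integral values alike and avoids dividing.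
  negated-half : ∀ {h} j → h + h ≈ fromℕ j → - h + - h + fromℕ (j ℕ.+ 2) ≈ fromℕ 2
  negated-half {h} j h+h≈j = begin
    - h + - h + fromℕ (j ℕ.+ 2)
      ≈⟨ +-cong (-‿+-comm h h) (trans (fromℕ-+ j 2) (+-congʳ (sym h+h≈j))) ⟩
    - (h + h) + (h + h + fromℕ 2)  ≈⟨ +-assoc _ _ _ ⟨
    - (h + h) + (h + h) + fromℕ 2  ≈⟨ +-congʳ (-‿inverseˡ (h + h)) ⟩
    0# + fromℕ 2                   ≈⟨ +-identityˡ _ ⟩
    fromℕ 2                        ∎

  0≤x+x⇒0≤x : ∀ {x} → 0# ≤ x + x → 0# ≤ x
  0≤x+x⇒0≤x {x} 0≤x+x x<0 = 0≤x+x (<-trans (+-monoʳ-< x x<0)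
    (<.<-respˡ-≈ (sym (+-identityʳ x)) x<0))

  sum-zero : ∀ {n} {f : Fin n → Carrier} → (∀ i → f i ≈ 0#) → sum f ≈ 0#
  sum-zero {n} f≈0 = trans (sum-cong-≋ f≈0) (sum-replicate-zero n)

  sum-single : ∀ {n} {f : Fin n → Carrier} i → (∀ j → j ≢ i → f j ≈ 0#) → sum f ≈ f i
  sum-single {suc n} {f} i f≈0 = begin
    sum f                         ≈⟨ sum-remove {i = i} f ⟩
    f i + sum (f ∘ Fin.punchIn i) ≈⟨ +-congˡ (sum-zero λ j → f≈0 _ (Fin.punchInᵢ≢i i j)) ⟩
    f i + 0#                      ≈⟨ +-identityʳ (f i) ⟩
    f i                           ∎

-- Walks, distances and Lipschitz functions in a finite digraph.

module Digraphs {v ℓ r} (Γ : FiniteDigraph v ℓ r) where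
  open FiniteDigraph Γ
  open Inverse enumeration using (inverseʳ)

  Walk-respˡ : ∀ {n x x′ y} → x ≈ x′ → Walk n x y → Walk n x′ y
  Walk-respˡ x≈x′ (stop x≈y)   = stop (trans (sym x≈x′) x≈y)
  Walk-respˡ x≈x′ (step x→z p) = step (proj₂ Arc-resp-≈ x≈x′ x→z) p

  Walk-respʳ : ∀ {n x y y′} → y ≈ y′ → Walk n x y → Walk n x y′
  Walk-respʳ y≈y′ (stop x≈y)   = stop (trans x≈y y≈y′)
  Walk-respʳ y≈y′ (step x→z p) = step x→z (Walk-respʳ y≈y′ p)

  infixr 5 _++_
  _++_ : ∀ {m n x y z} → Walk m x y → Walk n y z → Walk (m ℕ.+ n) x z
  stop x≈y   ++ q = Walk-respˡ (sym x≈y) q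
  step x→w p ++ q = step x→w (p ++ q)

  vertex-from : ∀ x → vertex (from x) ≈ x
  vertex-from x = inverseˡ ≡.refl

  walk? : ∀ n x y → Dec (Walk n x y)
  walk? zero    x y = map′ stop (λ { (stop x≈y) → x≈y }) (x ≟ y)
  walk? (suc n) x y = map′
    (λ { (i , x→i , p) → step x→i p })
    (λ { (step {y = z} x→z p) → from z , proj₁ Arc-resp-≈ (sym (vertex-from z)) x→z
                                       , Walk-respˡ (sym (vertex-from z)) p })
    (Fin.any? λ i → arc? x (vertex i) ×-dec walk? n (vertex i) y)

  -- Any walk bounds the search for a shortest one, and finiteness makes walks of a fixed length
  -- decidable, so no diameter bound has to be supplied.
  distance : (∀ x y → ∃[ n ] Walk n x y) → Distance
  distance connected = record
    { d        = λ x y → proj₁ (geodesic x y)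
    ; attained = λ x y → proj₁ (proj₂ (geodesic x y))
    ; shortest = λ {_} {x} {y} → proj₂ (proj₂ (geodesic x y))
    }
    where
    geodesic : ∀ x y → ∃[ k ] Walk k x y × (∀ {j} → Walk j x y → k ℕ.≤ j)
    geodesic x y = least (λ n → walk? n x y) (proj₁ (connected x y)) (proj₂ (connected x y))

  record OutNeighbours (x y z : V) : Set (v ⊔ ℓ ⊔ r) where
    field
      left     : Arc x y
      right    : Arc x z
      distinct : ¬ y ≈ z
      only     : ∀ {w} → Arc x w → y ≈ w ⊎ z ≈ w

    -- The filtered enumeration and the list of the two neighbours' indices are both free of
    -- repetitions and have the same members, so they are permutations of each other.
    outdegree≡2 : outdegree x ≡ 2
    outdegree≡2 = ↭-length (∼bag⇒↭ (unique∧set⇒bag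
      (filter⁺ x→? (allFin⁺ order))
      ((distinct ∘ from-injective ∷ []) ∷ [] ∷ [])
      (mk⇔ filter⇒neighbour neighbour⇒filter)))
      where
      x→? : Decidable (λ i → Arc x (vertex i))
      x→? i = arc? x (vertex i)
      from-injective : ∀ {y z} → from y ≡ from z → y ≈ z
      from-injective {y} {z} p = trans (sym (vertex-from y))
        (trans (reflexive (≡.cong vertex p)) (vertex-from z))
      from≡ : ∀ {y i} → y ≈ vertex i → i ≡ from y
      from≡ {y} {i} y≈i = ≡.sym (inverseʳ y≈i)
      filter⇒neighbour : ∀ {i} → i ∈ filter x→? (allFin order) → i ∈ from y ∷ from z ∷ []
      filter⇒neighbour i∈ = [ here ∘ from≡ , there ∘ here ∘ from≡ ]′
        (only (proj₂ (∈-filter⁻ x→? {xs = allFin order} i∈)))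
      neighbour⇒filter : ∀ {i} → i ∈ from y ∷ from z ∷ [] → i ∈ filter x→? (allFin order)
      neighbour⇒filter (here ≡.refl) =
        ∈-filter⁺ x→? (∈-allFin _) (proj₁ Arc-resp-≈ (sym (vertex-from y)) left)
      neighbour⇒filter (there (here ≡.refl)) =
        ∈-filter⁺ x→? (∈-allFin _) (proj₁ Arc-resp-≈ (sym (vertex-from z)) right)

  module Metric (δ : Distance) where
    open Distance δ

    d-cong : ∀ {x x′ y y′} → x ≈ x′ → y ≈ y′ → d x y ≡ d x′ y′
    d-cong x≈x′ y≈y′ = ℕ.≤-antisym
      (shortest (Walk-respˡ (sym x≈x′) (Walk-respʳ (sym y≈y′) (attained _ _))))
      (shortest (Walk-respˡ x≈x′ (Walk-respʳ y≈y′ (attained _ _))))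

    triangle : ∀ x y z → d x z ℕ.≤ d x y ℕ.+ d y z
    triangle x y z = shortest (attained x y ++ attained y z)

    d-refl : ∀ x → d x x ≡ 0
    d-refl x = ℕ.n≤0⇒n≡0 (shortest (stop refl))

    -- One-sided because `d` need not be symmetric: `f` may climb by at most `d x y` from `x` to
    -- `y`, while descents are limited only through `d y x`.
    Lipschitz : (V → ℕ) → Set v
    Lipschitz f = ∀ x y → f y ℕ.≤ f x ℕ.+ d x y

    Lipschitz-+d : ∀ k x → Lipschitz (λ y → k ℕ.+ d x y)
    Lipschitz-+d k x y z = ℕ.≤-trans (ℕ.+-monoʳ-≤ k (triangle x y z))
      (ℕ.≤-reflexive (≡.sym (ℕ.+-assoc k _ _)))

    Lipschitz-⊓ : ∀ {f g} → Lipschitz f → Lipschitz g → Lipschitz (λ x → f x ⊓ g x)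
    Lipschitz-⊓ {f} {g} f-lip g-lip x y = ℕ.≤-trans (ℕ.⊓-mono-≤ (f-lip x y) (g-lip x y))
      (ℕ.≤-reflexive (≡.sym (ℕ.+-distribʳ-⊓ (d x y) (f x) (g x))))

-- Optimal transport between two lazy walks of outdegree two.

module Transport {c ℓ₁ ℓ₂ ℓ₃ v ℓ r}
                 (ℝ : RealNumbers c ℓ₁ ℓ₂ ℓ₃) (Γ : FiniteDigraph v ℓ r) where
  open RealNumbers ℝ hiding (reflexive) renaming (Carrier to R; _≈_ to _≈ᴿ_)
  open CommutativeRing commutativeRing using (ring; semiring; commutativeSemiring)
  open SetoidReasoning setoid
  open SemiringSolver commutativeSemiring using (solve; _:=_; _:+_; _:*_)
  open SemiringSum semiring
    using (sum-cong-≋; ∑-distrib-+; ∑-comm; *-distribʳ-sum)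
  open RingProperties ring using (x≈z//y)
  open Reals ℝ
  open FiniteDigraph Γ
    using (V; Distance; vertex; from; order; _≟_; arc?; enumeration; loopless)
    renaming (_≈_ to _≈ⱽ_)
  private module ≈ⱽ = FiniteDigraph Γ
  open Digraphs Γ
  open Curvature ℝ Γ

  ∑-cong : ∀ (f g : V → R) → (∀ u → f u ≈ᴿ g u) → ∑ᵛ f ≈ᴿ ∑ᵛ g
  ∑-cong f g f≈g = sum-cong-≋ (λ i → f≈g (vertex i))

  ∑-+ : ∀ (f g : V → R) → ∑ᵛ (λ u → f u + g u) ≈ᴿ ∑ᵛ f + ∑ᵛ g
  ∑-+ f g = ∑-distrib-+ (f ∘ vertex) (g ∘ vertex)

  ∑-+-+ : ∀ (f g h : V → R) → ∑ᵛ (λ u → f u + g u + h u) ≈ᴿ ∑ᵛ f + ∑ᵛ g + ∑ᵛ h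
  ∑-+-+ f g h = trans (∑-+ (λ u → f u + g u) h) (+-congʳ (∑-+ f g))

  ∑-zero : ∀ (f : V → R) → (∀ u → f u ≈ᴿ 0#) → ∑ᵛ f ≈ᴿ 0#
  ∑-zero f f≈0 = sum-zero {order} {f ∘ vertex} (λ i → f≈0 (vertex i))

  ∑-single : ∀ {f : V → R} {x s} → (∀ {u} → x ≈ⱽ u → f u ≈ᴿ s) →
             (∀ {u} → ¬ x ≈ⱽ u → f u ≈ᴿ 0#) → ∑ᵛ f ≈ᴿ s
  ∑-single {f} {x} here≈ else≈0 = trans
    (sum-single (from x) λ j j≢ → else≈0 λ x≈j →
      j≢ (≡.sym (Inverse.inverseʳ enumeration x≈j)))
    (here≈ (≈ⱽ.sym (vertex-from x)))

  -- A multiple of the point measure at `x`. Nested as `mass (mass s y w) x u`, it is the weight `s`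
  -- on the single pair `(x , y)`, the building block of couplings.
  mass : R → V → V → R
  mass s x u with x ≟ u
  ... | yes _ = s
  ... | no  _ = 0#

  mass-≈ : ∀ s {x u} → x ≈ⱽ u → mass s x u ≈ᴿ s
  mass-≈ s {x} {u} x≈u with x ≟ u
  ... | yes _   = refl
  ... | no  x≉u = contradiction x≈u x≉u

  mass-≉ : ∀ s {x u} → ¬ x ≈ⱽ u → mass s x u ≈ᴿ 0#
  mass-≉ s {x} {u} x≉u with x ≟ u
  ... | yes x≈u = contradiction x≈u x≉u
  ... | no  _   = refl

  mass-elim : ∀ {p} (P : R → Set p) s x u → P s → P 0# → P (mass s x u)
  mass-elim P s x u Ps P0 with x ≟ u
  ... | yes _ = Ps
  ... | no  _ = P0

  mass-resp : ∀ {s s′ x u u′} → s ≈ᴿ s′ → u ≈ⱽ u′ → mass s x u ≈ᴿ mass s′ x u′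
  mass-resp {s} {s′} {x} {u} {u′} s≈s′ u≈u′ with x ≟ u
  ... | yes x≈u = trans s≈s′ (sym (mass-≈ s′ (≈ⱽ.trans x≈u u≈u′)))
  ... | no  x≉u = sym (mass-≉ s′ λ x≈u′ → x≉u (≈ⱽ.trans x≈u′ (≈ⱽ.sym u≈u′)))

  ∑-mass-* : ∀ s x (h : V → R) → (∀ {u} → x ≈ⱽ u → h u ≈ᴿ h x) →
             ∑ᵛ (λ u → mass s x u * h u) ≈ᴿ s * h x
  ∑-mass-* s x h h-cong = ∑-single
    (λ x≈u → *-cong (mass-≈ s x≈u) (h-cong x≈u))
    (λ {u} x≉u → trans (*-congʳ (mass-≉ s x≉u)) (zeroˡ (h u)))

  ∑-mass : ∀ s x → ∑ᵛ (mass s x) ≈ᴿ s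
  ∑-mass s x = ∑-single (mass-≈ s) (mass-≉ s)

  ∑-mass-mass : ∀ s x y u → ∑ᵛ (λ w → mass (mass s y w) x u) ≈ᴿ mass s x u
  ∑-mass-mass s x y u with x ≟ u
  ... | yes _ = ∑-mass s y
  ... | no  _ = ∑-zero (λ _ → 0#) λ _ → refl

  0≤mass : ∀ {s} x u → 0# ≤ s → 0# ≤ mass s x u
  0≤mass {s} x u 0≤s = mass-elim (0# ≤_) s x u 0≤s (≤-reflexive refl)

  mass≤ : ∀ {s} x u → 0# ≤ s → mass s x u ≤ s
  mass≤ {s} x u 0≤s = mass-elim (_≤ s) s x u (≤-reflexive refl) 0≤s

  half : R → R
  half α = (1# - α) /ℕ 2

  -- The three point masses never overlap: looplessness keeps `x` apart from its out-neighbours, and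
  -- `distinct` keeps these apart from each other.
  lazyWalk≈ : ∀ α {x y z} → OutNeighbours x y z → ∀ u →
              lazyWalk α x u ≈ᴿ mass α x u + mass (half α) y u + mass (half α) z u
  lazyWalk≈ α {x} {y} {z} N u with x ≟ u | arc? x u
  ... | yes x≈u | _ = sym (begin
    α + mass β y u + mass β z u
      ≈⟨ +-cong (+-congˡ (mass-≉ β (not-loop left))) (mass-≉ β (not-loop right)) ⟩
    α + 0# + 0#  ≈⟨ trans (+-identityʳ _) (+-identityʳ α) ⟩
    α            ∎)
    where
    open OutNeighbours N
    β = half α
    not-loop : ∀ {w} → ≈ⱽ.Arc x w → ¬ w ≈ⱽ u
    not-loop x→w w≈u =
      loopless (proj₁ ≈ⱽ.Arc-resp-≈ (≈ⱽ.trans w≈u (≈ⱽ.sym x≈u)) x→w)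
  ... | no  _   | yes x→u = trans (/ℕ-congʳ _ {{≈ⱽ.arc⇒outdegree≢0 x→u}} outdegree≡2) (sym (begin
    0# + mass β y u + mass β z u  ≈⟨ +-congʳ (+-identityˡ _) ⟩
    mass β y u + mass β z u       ≈⟨ [ at-y , at-z ]′ (only x→u) ⟩
    β                             ∎))
    where
    open OutNeighbours N
    β = half α
    at-y : y ≈ⱽ u → mass β y u + mass β z u ≈ᴿ β
    at-y y≈u = trans (+-cong (mass-≈ β y≈u)
      (mass-≉ β λ z≈u → distinct (≈ⱽ.trans y≈u (≈ⱽ.sym z≈u)))) (+-identityʳ β)
    at-z : z ≈ⱽ u → mass β y u + mass β z u ≈ᴿ β
    at-z z≈u = trans (+-cong
      (mass-≉ β λ y≈u → distinct (≈ⱽ.trans y≈u (≈ⱽ.sym z≈u))) (mass-≈ β z≈u)) (+-identityˡ β)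
  ... | no  _   | no x↛u = sym (begin
    0# + mass β y u + mass β z u
      ≈⟨ +-cong (+-congˡ (mass-≉ β (not-out left))) (mass-≉ β (not-out right)) ⟩
    0# + 0# + 0#  ≈⟨ trans (+-identityʳ _) (+-identityʳ 0#) ⟩
    0#            ∎)
    where
    open OutNeighbours N
    β = half α
    not-out : ∀ {w} → ≈ⱽ.Arc x w → ¬ w ≈ⱽ u
    not-out x→w w≈u = x↛u (proj₁ ≈ⱽ.Arc-resp-≈ w≈u x→w)

  module _ (δ : Distance) where
    open Distance δ
    open Metric δ

    -- The Lipschitz bounds are weighted by the plan and summed, and the marginals then turn both
    -- sides into integrals of `f`. The source integral stays on the right, so nothing is
    -- subtracted.
    weak-duality : ∀ {μ ν} (π : Coupling μ ν) {f : V → ℕ} → Lipschitz f →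
      ∑ᵛ (λ w → ν w * fromℕ (f w)) ≤ ∑ᵛ (λ u → μ u * fromℕ (f u)) + cost δ π
    weak-duality {μ} {ν} π {f} f-lip = ≤-resp left right
      (sum-mono-≤ λ i → sum-mono-≤ λ j →
        *-monoʳ-fromℕ (A≥0 (vertex i) (vertex j)) (f-lip (vertex i) (vertex j)))
      where
      open Coupling π
      F : V → R
      F u = fromℕ (f u)
      D : V → V → R
      D u w = fromℕ (d u w)
      left : ∑ᵛ (λ u → ∑ᵛ λ w → A u w * F w) ≈ᴿ ∑ᵛ (λ w → ν w * F w)
      left = begin
        ∑ᵛ (λ u → ∑ᵛ λ w → A u w * F w)
          ≈⟨ ∑-comm (λ i j → A (vertex i) (vertex j) * F (vertex j)) ⟩
        ∑ᵛ (λ w → ∑ᵛ λ u → A u w * F w)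
          ≈⟨ ∑-cong _ (λ w → ∑ᵛ λ u → A u w * F w)
               (λ w → *-distribʳ-sum (F w) (λ i → A (vertex i) w)) ⟨
        ∑ᵛ (λ w → ∑ᵛ (λ u → A u w) * F w)
          ≈⟨ ∑-cong _ (λ w → ν w * F w) (λ w → *-congʳ (marginalʳ w)) ⟩
        ∑ᵛ (λ w → ν w * F w) ∎
      split : ∀ u w → A u w * fromℕ (f u ℕ.+ d u w) ≈ᴿ A u w * F u + A u w * D u w
      split u w = trans (*-congˡ (fromℕ-+ (f u) (d u w))) (distribˡ (A u w) (F u) (D u w))
      right : ∑ᵛ (λ u → ∑ᵛ λ w → A u w * fromℕ (f u ℕ.+ d u w)) ≈ᴿ
              ∑ᵛ (λ u → μ u * F u) + cost δ π
      right = begin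
        ∑ᵛ (λ u → ∑ᵛ λ w → A u w * fromℕ (f u ℕ.+ d u w))
          ≈⟨ ∑-cong _ (λ u → ∑ᵛ (λ w → A u w * F u) + ∑ᵛ λ w → A u w * D u w) (λ u → trans
               (∑-cong _ (λ w → A u w * F u + A u w * D u w) (split u))
               (∑-+ (λ w → A u w * F u) (λ w → A u w * D u w))) ⟩
        ∑ᵛ (λ u → ∑ᵛ (λ w → A u w * F u) + ∑ᵛ λ w → A u w * D u w)
          ≈⟨ ∑-+ (λ u → ∑ᵛ λ w → A u w * F u) (λ u → ∑ᵛ λ w → A u w * D u w) ⟩
        ∑ᵛ (λ u → ∑ᵛ λ w → A u w * F u) + cost δ π
          ≈⟨ +-congʳ (∑-cong _ (λ u → μ u * F u) λ u → trans
               (sym (*-distribʳ-sum (F u) (λ j → A u (vertex j))))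
               (*-congʳ (marginalˡ u))) ⟩
        ∑ᵛ (λ u → μ u * F u) + cost δ π ∎

    ∑∑-mass : ∀ s x y →
      ∑ᵛ (λ u → ∑ᵛ λ w → mass (mass s y w) x u * fromℕ (d u w)) ≈ᴿ s * fromℕ (d x y)
    ∑∑-mass s x y = ∑-single
      (λ x≈u → ∑-single
        (λ y≈w → *-cong (trans (mass-≈ _ x≈u) (mass-≈ s y≈w))
          (reflexive (≡.cong fromℕ (≡.sym (d-cong x≈u y≈w)))))
        (λ y≉w → trans (*-congʳ (trans (mass-≈ _ x≈u) (mass-≉ s y≉w))) (zeroˡ _)))
      (λ {u} x≉u → ∑-zero (λ w → mass (mass s y w) x u * fromℕ (d u w)) λ w →
        trans (*-congʳ (mass-≉ (mass s y w) x≉u)) (zeroˡ _))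
      where reflexive = CommutativeRing.reflexive commutativeRing

    module Optimal {o x y p q} (N-o : OutNeighbours o x y) (N-x : OutNeighbours x p q)
                   {k} (k≤5 : k ℕ.≤ 5)
                   (ox≡1 : d o x ≡ 1) (xp≡1 : d x p ≡ 1) (yq≡k : d y q ≡ k)
                   (op≥2 : 2 ℕ.≤ d o p) (oq≥2 : 2 ℕ.≤ d o q) (xq≥1 : 1 ℕ.≤ d x q)
                   (yx≥k-1 : k ℕ.≤ suc (d y x)) (yp≥k : k ℕ.≤ d y p) where

      φ : V → ℕ
      φ u = (3 ℕ.+ d o u) ⊓ (4 ℕ.+ d x u) ⊓ ((5 ∸ k) ℕ.+ d y u)

      φ-lip : Lipschitz φ
      φ-lip = Lipschitz-⊓ (Lipschitz-⊓ (Lipschitz-+d 3 o) (Lipschitz-+d 4 x)) (Lipschitz-+d (5 ∸ k) y)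

      φ-cong : ∀ {u w} → u ≈ⱽ w → φ u ≡ φ w
      φ-cong u≈w = ≡.cong₂ _⊓_
        (≡.cong₂ (λ i j → (3 ℕ.+ i) ⊓ (4 ℕ.+ j)) (d-cong ≈ⱽ.refl u≈w) (d-cong ≈ⱽ.refl u≈w))
        (≡.cong ((5 ∸ k) ℕ.+_) (d-cong ≈ⱽ.refl u≈w))

      at-base : ∀ j u → j ℕ.+ d u u ≡ j
      at-base j u = ≡.trans (≡.cong (j ℕ.+_) (d-refl u)) (ℕ.+-identityʳ j)

      -- Upper bounds on `φ` are proved where the walk from `o` has mass, lower bounds where the
      -- walk from `x` has mass. The vertex `x` belongs to both supports.
      φo≤3 : φ o ℕ.≤ 3
      φo≤3 = ℕ.≤-trans (ℕ.m⊓n≤m _ _) (ℕ.≤-trans (ℕ.m⊓n≤m _ _) (ℕ.≤-reflexive (at-base 3 o)))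

      φx≤4 : φ x ℕ.≤ 4
      φx≤4 = ℕ.≤-trans (ℕ.m⊓n≤m _ _) (ℕ.≤-trans (ℕ.m⊓n≤n _ _) (ℕ.≤-reflexive (at-base 4 x)))

      φy≤5-k : φ y ℕ.≤ 5 ∸ k
      φy≤5-k = ℕ.≤-trans (ℕ.m⊓n≤n _ _) (ℕ.≤-reflexive (at-base (5 ∸ k) y))

      5≤5-k+ : ∀ {j} → k ℕ.≤ j → 5 ℕ.≤ (5 ∸ k) ℕ.+ j
      5≤5-k+ k≤j = ℕ.≤-trans (ℕ.≤-reflexive (≡.sym (ℕ.m∸n+n≡m k≤5))) (ℕ.+-monoʳ-≤ (5 ∸ k) k≤j)

      φx≥4 : 4 ℕ.≤ φ x
      φx≥4 = ℕ.⊓-glb (ℕ.⊓-glb (ℕ.+-monoʳ-≤ 3 (ℕ.≤-reflexive (≡.sym ox≡1))) (ℕ.m≤m+n 4 _))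
        -- The cone at `y` only has to reach 4 here, so the bound 5 is applied to `suc (d y x)` and
        -- one successor is dropped.
        (ℕ.≤-pred (ℕ.≤-trans (5≤5-k+ yx≥k-1) (ℕ.≤-reflexive (ℕ.+-suc (5 ∸ k) _))))

      φp≥5 : 5 ℕ.≤ φ p
      φp≥5 = ℕ.⊓-glb (ℕ.⊓-glb (ℕ.+-monoʳ-≤ 3 op≥2) (ℕ.+-monoʳ-≤ 4 (ℕ.≤-reflexive (≡.sym xp≡1))))
        (5≤5-k+ yp≥k)

      φq≥5 : 5 ℕ.≤ φ q
      φq≥5 = ℕ.⊓-glb (ℕ.⊓-glb (ℕ.+-monoʳ-≤ 3 oq≥2) (ℕ.+-monoʳ-≤ 4 xq≥1))
        (5≤5-k+ (ℕ.≤-reflexive (≡.sym yq≡k)))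

      module _ (α : R) (0≤α : 0# ≤ α) (α<1 : α < 1#) where

        β : R
        β = half α

        2β≈1-α : β + β ≈ᴿ 1# - α
        2β≈1-α = x/2+x/2≈x (1# - α)

        α+2β≈1 : α + (β + β) ≈ᴿ 1#
        α+2β≈1 = begin
          α + (β + β)    ≈⟨ +-congˡ 2β≈1-α ⟩
          α + (1# - α)   ≈⟨ +-comm α (1# - α) ⟩
          1# - α + α     ≈⟨ +-assoc 1# (- α) α ⟩
          1# + (- α + α) ≈⟨ +-congˡ (-‿inverseˡ α) ⟩
          1# + 0#        ≈⟨ +-identityʳ 1# ⟩
          1#             ∎

        0≤β : 0# ≤ β
        -- The sign of β is read off from β + β = 1 - α, without any information on the sign of the
        -- inverse of 2.
        0≤β = 0≤x+x⇒0≤x (+-cancelˡ-≤ α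
          (≤-resp (sym (+-identityʳ α)) (sym α+2β≈1) (<⇒≤ α<1)))

        W : R
        W = α + β * fromℕ (suc k)

        plan : Coupling (lazyWalk α o) (lazyWalk α x)
        plan = record
          { A         = λ u w → mass (mass α x w) o u + mass (mass β p w) x u + mass (mass β q w) y u
          ; A-cong    = λ u≈u′ w≈w′ → +-cong (+-cong
                          (mass-resp (mass-resp refl w≈w′) u≈u′)
                          (mass-resp (mass-resp refl w≈w′) u≈u′))
                          (mass-resp (mass-resp refl w≈w′) u≈u′)
          ; A≥0       = λ u w → ≤-resp (trans (+-identityʳ _) (+-identityʳ 0#)) refl (+-mono-≤ (+-mono-≤
                          (0≤mass o u (0≤mass x w 0≤α))
                          (0≤mass x u (0≤mass p w 0≤β)))
                          (0≤mass y u (0≤mass q w 0≤β)))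
          -- Each of the three summands is at most its own weight, and the weights α, β, β add up to
          -- 1.
          ; A≤1       = λ u w → ≤-resp refl (trans (+-assoc α β β) α+2β≈1) (+-mono-≤ (+-mono-≤
                          (≤-trans (mass≤ o u (0≤mass x w 0≤α)) (mass≤ x w 0≤α))
                          (≤-trans (mass≤ x u (0≤mass p w 0≤β)) (mass≤ p w 0≤β)))
                          (≤-trans (mass≤ y u (0≤mass q w 0≤β)) (mass≤ q w 0≤β)))
          ; marginalˡ = λ u → trans
              (∑-+-+ (λ w → mass (mass α x w) o u) (λ w → mass (mass β p w) x u)
                (λ w → mass (mass β q w) y u))
              (trans (+-cong (+-cong (∑-mass-mass α o x u) (∑-mass-mass β x p u)) (∑-mass-mass β y q u))
                (sym (lazyWalk≈ α N-o u)))
          ; marginalʳ = λ w → trans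
              (∑-+-+ (mass (mass α x w) o) (mass (mass β p w) x) (mass (mass β q w) y))
              (trans (+-cong (+-cong (∑-mass (mass α x w) o) (∑-mass (mass β p w) x)) (∑-mass (mass β q w) y))
                (sym (lazyWalk≈ α N-x w)))
          }

        cost-plan : cost δ plan ≈ᴿ W
        cost-plan = begin
          ∑ᵛ (λ u → ∑ᵛ λ w → (P u w + Q u w + S u w) * D u w)
            ≈⟨ ∑-cong _ (λ u → total P u + total Q u + total S u) (λ u → trans
                 (∑-cong _ (λ w → P u w * D u w + Q u w * D u w + S u w * D u w) (λ w → trans
                   (distribʳ (D u w) (P u w + Q u w) (S u w))
                   (+-congʳ (distribʳ (D u w) (P u w) (Q u w)))))
                 (∑-+-+ (λ w → P u w * D u w) (λ w → Q u w * D u w) (λ w → S u w * D u w))) ⟩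
          ∑ᵛ (λ u → total P u + total Q u + total S u)
            ≈⟨ ∑-+-+ (total P) (total Q) (total S) ⟩
          ∑ᵛ (total P) + ∑ᵛ (total Q) + ∑ᵛ (total S)
            ≈⟨ +-cong (+-cong (∑∑-mass α o x) (∑∑-mass β x p)) (∑∑-mass β y q) ⟩
          α * D o x + β * D x p + β * D y q
            ≈⟨ +-cong (+-cong (*-congˡ (D≈ ox≡1)) (*-congˡ (D≈ xp≡1))) (*-congˡ (D≈ yq≡k)) ⟩
          α * fromℕ 1 + β * fromℕ 1 + β * fromℕ k
            ≈⟨ +-congʳ (+-cong (trans (*-congˡ (+-identityʳ 1#)) (*-identityʳ α)) (*-congˡ (+-identityʳ 1#))) ⟩
          α + β * 1# + β * fromℕ k
            ≈⟨ solve 4 (λ a b i f → a :+ b :* i :+ b :* f := a :+ b :* (i :+ f)) refl α β 1# (fromℕ k) ⟩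
          W ∎
          where
          P Q S : V → V → R
          P u w = mass (mass α x w) o u
          Q u w = mass (mass β p w) x u
          S u w = mass (mass β q w) y u
          D : V → V → R
          D u w = fromℕ (d u w)
          total : (V → V → R) → V → R
          total B u = ∑ᵛ λ w → B u w * D u w
          D≈ : ∀ {m n} → m ≡ n → fromℕ m ≈ᴿ fromℕ n
          D≈ ≡.refl = refl

        ∑-lazyWalk-φ : ∀ {u s t} → OutNeighbours u s t →
          ∑ᵛ (λ w → lazyWalk α u w * fromℕ (φ w)) ≈ᴿ
          α * fromℕ (φ u) + β * fromℕ (φ s) + β * fromℕ (φ t)
        ∑-lazyWalk-φ {u} {s} {t} N = begin
          ∑ᵛ (λ w → lazyWalk α u w * F w)
            ≈⟨ ∑-cong _ (λ w → mass α u w * F w + mass β s w * F w + mass β t w * F w) (λ w →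
                 trans (*-congʳ (lazyWalk≈ α N w)) (trans
                   (distribʳ (F w) (mass α u w + mass β s w) (mass β t w))
                   (+-congʳ (distribʳ (F w) (mass α u w) (mass β s w))))) ⟩
          ∑ᵛ (λ w → mass α u w * F w + mass β s w * F w + mass β t w * F w)
            ≈⟨ ∑-+-+ (λ w → mass α u w * F w) (λ w → mass β s w * F w) (λ w → mass β t w * F w) ⟩
          ∑ᵛ (λ w → mass α u w * F w) + ∑ᵛ (λ w → mass β s w * F w) + ∑ᵛ (λ w → mass β t w * F w)
            ≈⟨ +-cong (+-cong (∑-mass-* α u F F-cong) (∑-mass-* β s F F-cong)) (∑-mass-* β t F F-cong) ⟩
          α * F u + β * F s + β * F t ∎
          where
          F : V → R
          F w = fromℕ (φ w)
          F-cong : ∀ {w w′} → w ≈ⱽ w′ → F w′ ≈ᴿ F w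
          F-cong w≈w′ = CommutativeRing.reflexive commutativeRing (≡.cong fromℕ (≡.sym (φ-cong w≈w′)))

        W≤cost : (π : Coupling (lazyWalk α o) (lazyWalk α x)) → W ≤ cost δ π
        -- `lower` bounds the source integral of `φ` from above. By `balance`, `lower + W` bounds
        -- the target integral from below, so weak duality gives the claim once `lower` is
        -- cancelled.
        W≤cost π = +-cancelˡ-≤ lower (≤-resp (sym balance) refl
          (≤-trans (+-mono-≤ (+-mono-≤
              (*-monoʳ-fromℕ 0≤α φx≥4) (*-monoʳ-fromℕ 0≤β φp≥5)) (*-monoʳ-fromℕ 0≤β φq≥5))
          (≤-trans (≤-resp (∑-lazyWalk-φ N-x) (+-congʳ (∑-lazyWalk-φ N-o)) (weak-duality π φ-lip))
          (+-mono-≤ (+-mono-≤ (+-mono-≤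
              (*-monoʳ-fromℕ 0≤α φo≤3) (*-monoʳ-fromℕ 0≤β φx≤4)) (*-monoʳ-fromℕ 0≤β φy≤5-k))
            (≤-reflexive refl)))))
          where
          lower : R
          lower = α * fromℕ 3 + β * fromℕ 4 + β * fromℕ (5 ∸ k)
          5≈ : fromℕ 5 ≈ᴿ fromℕ (5 ∸ k) + fromℕ k
          5≈ = trans (CommutativeRing.reflexive commutativeRing (≡.cong fromℕ (≡.sym (ℕ.m∸n+n≡m k≤5))))
            (fromℕ-+ (5 ∸ k) k)
          balance : lower + W ≈ᴿ α * fromℕ 4 + β * fromℕ 5 + β * fromℕ 5
          balance = begin
            α * fromℕ 3 + β * fromℕ 4 + β * fromℕ (5 ∸ k) + (α + β * (1# + fromℕ k))
              ≈⟨ +-congˡ (+-congʳ (*-identityʳ α)) ⟨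
            α * fromℕ 3 + β * fromℕ 4 + β * fromℕ (5 ∸ k) + (α * 1# + β * (1# + fromℕ k))
              -- `1#` is passed to the solver as the variable `i`, because `fromℕ 4` and `fromℕ 5`
              -- unfold to `1# + fromℕ 3` and `1# + fromℕ 4`. This is why α was first rewritten as
              -- `α * 1#`.
              ≈⟨ solve 7 (λ a b t f i j g → a :* t :+ b :* f :+ b :* j :+ (a :* i :+ b :* (i :+ g))
                            := a :* (i :+ t) :+ b :* (i :+ f) :+ b :* (j :+ g))
                   refl α β (fromℕ 3) (fromℕ 4) 1# (fromℕ (5 ∸ k)) (fromℕ k) ⟩
            α * fromℕ 4 + β * fromℕ 5 + β * (fromℕ (5 ∸ k) + fromℕ k)
              ≈⟨ +-congˡ (*-congˡ 5≈) ⟨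
            α * fromℕ 4 + β * fromℕ 5 + β * fromℕ 5 ∎

        W-optimal : IsWasserstein δ (lazyWalk α o) (lazyWalk α x) W
        W-optimal = record
          { lowerBound = λ { t (π , t≈) → ≤-resp refl (sym t≈) (W≤cost π) }
          ; greatest   = λ l l≤ → l≤ W (plan , sym cost-plan)
          }

      limitCurvature : ∀ {κ} → κ + κ + fromℕ (suc k) ≈ᴿ fromℕ 2 →
                       (o≉x : ¬ o ≈ⱽ x) → IsLimitCurvature δ o≉x κ
      -- The quotient equals κ for every α in [0, 1), not only in the limit, so η = 1 serves every
      -- ε.
      limitCurvature {κ} κ-eq o≉x ε 0<ε = 1# , 0<1 , λ α 0≤α _ α<1 →
        let
          q≈κ = begin
            (1# - (W α 0≤α α<1 /ℕ d o x) {{d≢0 o≉x}}) * 1/ (#-sym (<⇒# α<1))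
              ≈⟨ *-congʳ (trans (+-congˡ (-‿cong (trans (/ℕ-congʳ _ {{d≢0 o≉x}} ox≡1) (x/1≈x _))))
                                (lazyCurvature α 0≤α α<1)) ⟩
            κ * (1# - α) * 1/ (#-sym (<⇒# α<1))    ≈⟨ *-assoc _ _ _ ⟩
            κ * ((1# - α) * 1/ (#-sym (<⇒# α<1)))  ≈⟨ *-congˡ (*-1/ _) ⟩
            κ * 1#                                 ≈⟨ *-identityʳ κ ⟩
            κ                                      ∎
        in _ , (W α 0≤α α<1 , W-optimal α 0≤α α<1 , refl)
             , <-respʳ-≈ (sym q≈κ) κ-ε<κ , <-respˡ-≈ (sym q≈κ) κ<κ+ε
        where
        open IsStrictPartialOrder isStrictPartialOrder using (<-respˡ-≈)
        κ<κ+ε : κ < κ + ε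
        κ<κ+ε = <-respˡ-≈ (+-identityʳ κ) (+-monoʳ-< κ 0<ε)
        κ-ε<κ : κ - ε < κ
        κ-ε<κ = <-respʳ-≈ (trans (+-assoc κ (- ε) ε) (trans (+-congˡ (-‿inverseˡ ε)) (+-identityʳ κ)))
          (<-respˡ-≈ (+-identityʳ (κ - ε)) (+-monoʳ-< (κ - ε) 0<ε))
        lazyCurvature : ∀ α 0≤α α<1 → 1# - W α 0≤α α<1 ≈ᴿ κ * (1# - α)
        -- With 1 - α = 2β, the sum κ(1 - α) + W becomes α + β(2κ + c) = α + 2β = 1.
        lazyCurvature α 0≤α α<1 = sym (x≈z//y _ _ 1# (begin
          κ * (1# - α) + (α + b * fromℕ (suc k))
            ≈⟨ +-congʳ (*-congˡ (2β≈1-α α 0≤α α<1)) ⟨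
          κ * (b + b) + (α + b * fromℕ (suc k))
            ≈⟨ solve 4 (λ κ b a c → κ :* (b :+ b) :+ (a :+ b :* c) := a :+ b :* (κ :+ κ :+ c))
                 refl κ b α (fromℕ (suc k)) ⟩
          α + b * (κ + κ + fromℕ (suc k))
            ≈⟨ +-congˡ (*-congˡ (trans κ-eq (+-congˡ (+-identityʳ 1#)))) ⟩
          α + b * (1# + 1#)
            ≈⟨ +-congˡ (trans (distribˡ b 1# 1#) (+-cong (*-identityʳ b) (*-identityʳ b))) ⟩
          α + (b + b)  ≈⟨ α+2β≈1 α 0≤α α<1 ⟩
          1#           ∎))
          where b = half α

open import Defs
open import Data.Nat using (_*_; _≤_; _<_)
open import Data.Integer using (_-_; -_)

-- Integers modulo N.

module Congruence (N : ℕ) where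
  infix 4 _≋_
  -- A record rather than a synonym for divisibility of `i - j`, so that both endpoints can be
  -- inferred from the type of a congruence.
  record _≋_ (i j : ℤ) : Set where
    constructor congruent
    field N∣i-j : + N ∣ℤ i - j

  ≋-reflexive : ∀ {i j} → i ≡ j → i ≋ j
  ≋-reflexive {i} ≡.refl = congruent (divides 0ℤ (ℤ.+-inverseʳ i))

  ≋-sym : ∀ {i j} → i ≋ j → j ≋ i
  ≋-sym {i} {j} (congruent p) = congruent (≡.subst (+ N ∣ℤ_) (swap i j) (∣m⇒∣-m p))
    where
    swap : ∀ i j → - (i - j) ≡ j - i
    swap = solve-∀

  ≋-trans : ∀ {i j k} → i ≋ j → j ≋ k → i ≋ k
  ≋-trans {i} {j} {k} (congruent p) (congruent q) =
    congruent (≡.subst (+ N ∣ℤ_) (telescope i j k) (∣m∣n⇒∣m+n p q))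
    where
    telescope : ∀ i j k → (i - j) ℤ.+ (j - k) ≡ i - k
    telescope = solve-∀

  +-cong : ∀ {i i′ j j′} → i ≋ i′ → j ≋ j′ → i ℤ.+ j ≋ i′ ℤ.+ j′
  +-cong {i} {i′} {j} {j′} (congruent p) (congruent q) =
    congruent (≡.subst (+ N ∣ℤ_) (regroup i i′ j j′) (∣m∣n⇒∣m+n p q))
    where
    regroup : ∀ i i′ j j′ → (i - i′) ℤ.+ (j - j′) ≡ (i ℤ.+ j) - (i′ ℤ.+ j′)
    regroup = solve-∀

  -‿cong : ∀ {i j} → i ≋ j → - i ≋ - j
  -‿cong {i} {j} (congruent p) = congruent (≡.subst (+ N ∣ℤ_) (ℤ.neg-distrib-+ i (- j)) (∣m⇒∣-m p))

  +N≋ : ∀ i → i ℤ.+ + N ≋ i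
  +N≋ i = congruent (divides 1ℤ (lemma i (+ N)))
    where
    lemma : ∀ i n → (i ℤ.+ n) - i ≡ 1ℤ ℤ.* n
    lemma = solve-∀

  ∣i∣<N⇒i≡0 : ∀ {i} → + N ∣ℤ i → ∣ i ∣ < N → i ≡ 0ℤ
  ∣i∣<N⇒i≡0 {i} N∣i ∣i∣<N with ∣ i ∣ in ∣i∣≡ | ∣⇒∣ᵤ N∣i
  ... | zero  | _   = ℤ.∣i∣≡0⇒i≡0 ∣i∣≡
  ... | suc n | N∣n = contradiction N∣n (ℕ.>⇒∤ ∣i∣<N)

  residue : .{{NonZero N}} → ℤ → Fin N
  residue i = Fin.fromℕ< (ℤ.n%ℕd<d i N)

  residue-≋ : .{{_ : NonZero N}} → ∀ i → i ≋ + Fin.toℕ (residue i)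
  residue-≋ i rewrite Fin.toℕ-fromℕ< (ℤ.n%ℕd<d i N) = congruent (divides (i ℤ./ℕ N) (begin
    i - + r                        ≡⟨ ≡.cong (_- + r) (ℤ.a≡a%ℕn+[a/ℕn]*n i N) ⟩
    + r ℤ.+ i ℤ./ℕ N ℤ.* + N - + r   ≡⟨ lemma (+ r) (i ℤ./ℕ N ℤ.* + N) ⟩
    i ℤ./ℕ N ℤ.* + N                 ∎))
    where
    open ≡.≡-Reasoning
    r = i ℤ.%ℕ N
    lemma : ∀ i j → (i ℤ.+ j) - i ≡ j
    lemma = solve-∀

  ≋⇒≡ : ∀ {x y : Fin N} → + Fin.toℕ x ≋ + Fin.toℕ y → x ≡ y
  ≋⇒≡ {x} {y} (congruent N∣) = Fin.toℕ-injective (ℤ.+-injective (ℤ.i-j≡0⇒i≡j _ _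
    (∣i∣<N⇒i≡0 N∣ (ℕ.≤-<-trans bound (ℕ.⊔-lub (Fin.toℕ<n x) (Fin.toℕ<n y))))))
    where
    bound : ∣ + Fin.toℕ x - + Fin.toℕ y ∣ ≤ Fin.toℕ x ℕ.⊔ Fin.toℕ y
    bound = ℕ.≤-trans (ℕ.≤-reflexive (≡.cong ∣_∣ (ℤ.[+m]-[+n]≡m⊖n (Fin.toℕ x) (Fin.toℕ y))))
      (ℤ.∣m⊝n∣≤m⊔n (Fin.toℕ x) (Fin.toℕ y))

xor-cancelʳ : ∀ x y → (x xor y) xor y ≡ x
xor-cancelʳ x y = ≡.trans (Bool.xor-assoc x y y)
  (≡.trans (≡.cong (x xor_) (Bool.xor-same y)) (Bool.xor-identityʳ x))

-- Normal forms and the word problem in the quaternion group.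

module Quaternion (m : ℕ) .{{_ : NonZero m}} where
  open Congruence (2 * m)
  open SetoidReasoning (Group.setoid (Q₄ m))

  instance
    2m≢0 : NonZero (2 * m)
    2m≢0 = ℕ.m*n≢0 2 m

  infix 4 _≈_
  _≈_ : Term Generator → Term Generator → Set
  _≈_ = Derivable (QuaternionRelation m)

  parity : Term Generator → Bool
  parity (gen 𝕒) = false
  parity (gen 𝕓) = true
  parity e       = false
  parity (s ∙ t) = parity s xor parity t
  parity (t ⁻¹)  = parity t

  shiftᵍ : Bool → Generator → ℤ
  shiftᵍ false 𝕒 = 1ℤ
  shiftᵍ true  𝕒 = -1ℤ
  shiftᵍ false 𝕓 = 0ℤ
  shiftᵍ true  𝕓 = + m

  -- Right multiplication by t sends aⁱ bˡ to a^(i + shift l t) b^(l xor parity t).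
  shift : Bool → Term Generator → ℤ
  shift l (gen x) = shiftᵍ l x
  shift l e       = 0ℤ
  shift l (s ∙ t) = shift l s ℤ.+ shift (l xor parity s) t
  shift l (t ⁻¹)  = - shift (l xor parity t) t

  parity-a^ : ∀ k → parity (a ^ k) ≡ false
  parity-a^ zero    = ≡.refl
  parity-a^ (suc k) = parity-a^ k

  shift-a^ : ∀ k → shift false (a ^ k) ≡ + k
  shift-a^ zero    = ≡.refl
  shift-a^ (suc k) = ≡.cong (λ x → 1ℤ ℤ.+ x) (shift-a^ k)

  shift-true-a^ : ∀ k → shift true (a ^ k) ≡ - + k
  shift-true-a^ zero    = ≡.refl
  shift-true-a^ (suc k) = ≡.trans
    (≡.cong (λ x → -1ℤ ℤ.+ x) (shift-true-a^ k)) (≡.sym (ℤ.neg-distrib-+ 1ℤ (+ k)))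

  parity-cong : ∀ {s t} → s ≈ t → parity s ≡ parity t
  parity-cong (relation a²ᵐ≈e)     = parity-a^ (2 * m)
  parity-cong (relation b²≈aᵐ)     = ≡.sym (parity-a^ m)
  parity-cong (relation b⁻¹ab≈a⁻¹) = ≡.refl
  parity-cong refl            = ≡.refl
  parity-cong (sym p)         = ≡.sym (parity-cong p)
  parity-cong (trans p q)     = ≡.trans (parity-cong p) (parity-cong q)
  parity-cong (∙-cong p q)    = ≡.cong₂ _xor_ (parity-cong p) (parity-cong q)
  parity-cong (⁻¹-cong p)     = parity-cong p
  parity-cong (assoc s t u)   = Bool.xor-assoc (parity s) (parity t) (parity u)
  parity-cong (identityˡ t)   = ≡.refl
  parity-cong (identityʳ t)   = Bool.xor-identityʳ (parity t)
  parity-cong (inverseˡ t)    = Bool.xor-same (parity t)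
  parity-cong (inverseʳ t)    = Bool.xor-same (parity t)

  -- The incoming parity `l` is kept general for the sake of products: the right factor is evaluated
  -- at `l xor parity s`, not at `l`.
  shift-cong : ∀ {s t} → s ≈ t → ∀ l → shift l s ≋ shift l t
  shift-cong (relation a²ᵐ≈e) false rewrite shift-a^ (2 * m)      = +N≋ 0ℤ
  shift-cong (relation a²ᵐ≈e) true  rewrite shift-true-a^ (2 * m) =
    ≋-sym (congruent (divides 1ℤ (lemma (+ (2 * m)))))
    where
    lemma : ∀ n → 0ℤ - - n ≡ 1ℤ ℤ.* n
    lemma = solve-∀
  shift-cong (relation b²≈aᵐ) false rewrite shift-a^ m =
    ≋-reflexive (≡.trans (ℤ.+-identityˡ _) (ℤ.+-identityʳ (+ m)))
  -- Behind a factor `b`, the word `b²` contributes m but `a^m` contributes -m, so the two agree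
  -- only modulo 2m.
  shift-cong (relation b²≈aᵐ) true  rewrite shift-true-a^ m = congruent (divides 1ℤ
    (≡.trans (lemma (+ m)) (≡.cong (1ℤ ℤ.*_) (≡.sym (ℤ.pos-* 2 m)))))
    where
    lemma : ∀ n → n ℤ.+ (0ℤ ℤ.+ 0ℤ) - - n ≡ 1ℤ ℤ.* (+ 2 ℤ.* n)
    lemma = solve-∀
  shift-cong (relation b⁻¹ab≈a⁻¹) false = ≋-reflexive (lemma (+ m))
    where
    lemma : ∀ n → (- n ℤ.+ -1ℤ) ℤ.+ n ≡ -1ℤ
    lemma = solve-∀
  shift-cong (relation b⁻¹ab≈a⁻¹) true  = ≋-reflexive ≡.refl
  shift-cong refl l          = ≋-reflexive ≡.refl
  shift-cong (sym p) l       = ≋-sym (shift-cong p l)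
  shift-cong (trans p q) l   = ≋-trans (shift-cong p l) (shift-cong q l)
  shift-cong (∙-cong {s} {s′} {_} {t′} p q) l = ≋-trans
    (+-cong (shift-cong p l) (shift-cong q (l xor parity s)))
    (≋-reflexive (≡.cong (λ x → shift l s′ ℤ.+ shift (l xor x) t′) (parity-cong p)))
  shift-cong (⁻¹-cong {s} {t} p) l = ≋-trans (-‿cong (shift-cong p (l xor parity s)))
    (≋-reflexive (≡.cong (λ x → - shift (l xor x) t) (parity-cong p)))
  shift-cong (assoc s t u) l = ≋-reflexive (≡.trans (ℤ.+-assoc (shift l s) _ _)
    (≡.cong (λ x → shift l s ℤ.+ (shift (l xor parity s) t ℤ.+ shift x u))
      (≡.sym (Bool.xor-assoc l (parity s) (parity t)))))
  shift-cong (identityˡ t) l = ≋-reflexive (≡.trans (ℤ.+-identityˡ _)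
    (≡.cong (λ x → shift x t) (Bool.xor-identityʳ l)))
  shift-cong (identityʳ t) l = ≋-reflexive (ℤ.+-identityʳ (shift l t))
  shift-cong (inverseˡ t) l  = ≋-reflexive (ℤ.+-inverseˡ (shift (l xor parity t) t))
  shift-cong (inverseʳ t) l  = ≋-reflexive (≡.trans
    (≡.cong (λ x → shift l t ℤ.+ - shift x t) (xor-cancelʳ l (parity t)))
    (ℤ.+-inverseʳ (shift l t)))

  a^-+ : ∀ j k → a ^ (j ℕ.+ k) ≈ a ^ j ∙ a ^ k
  a^-+ zero    k = sym (identityˡ _)
  a^-+ (suc j) k = trans (∙-cong refl (a^-+ j k)) (sym (assoc _ _ _))

  a^-period : ∀ k n → a ^ (k ℕ.+ n * (2 * m)) ≈ a ^ k
  a^-period k n = begin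
    a ^ (k ℕ.+ n * (2 * m))      ≈⟨ a^-+ k _ ⟩
    a ^ k ∙ a ^ (n * (2 * m))    ≈⟨ ∙-cong refl (trivial n) ⟩
    a ^ k ∙ e                    ≈⟨ identityʳ _ ⟩
    a ^ k                        ∎
    where
    trivial : ∀ n → a ^ (n * (2 * m)) ≈ e
    trivial zero    = refl
    trivial (suc n) = trans (a^-+ (2 * m) _)
      (trans (∙-cong (relation a²ᵐ≈e) (trivial n)) (identityˡ e))

  a^-cong : ∀ {j k} → + j ≋ + k → a ^ j ≈ a ^ k
  a^-cong {j} {k} (congruent (divides (+ n) eq)) =
    trans (G.reflexive (≡.cong (a ^_) j≡)) (a^-period k n)
    where
    module G = Group (Q₄ m)
    lemma : ∀ i j → i ≡ j ℤ.+ (i - j)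
    lemma = solve-∀
    j≡ : j ≡ k ℕ.+ n * (2 * m)
    j≡ = ℤ.+-injective (≡.trans (lemma (+ j) (+ k))
      (≡.cong (λ x → + k ℤ.+ x) (≡.trans eq (≡.sym (ℤ.pos-* n (2 * m))))))
  a^-cong {j} {k} (congruent (divides -[1+ n ] eq)) =
    sym (trans (G.reflexive (≡.cong (a ^_) k≡)) (a^-period j (suc n)))
    where
    module G = Group (Q₄ m)
    lemma : ∀ i j → j ≡ i ℤ.+ - (i - j)
    lemma = solve-∀
    k≡ : k ≡ j ℕ.+ suc n * (2 * m)
    k≡ = ℤ.+-injective (≡.trans (lemma (+ j) (+ k)) (≡.cong (λ x → + j ℤ.+ x) (≡.trans (≡.cong -_ eq)
      (≡.trans (ℤ.neg-distribˡ-* -[1+ n ] (+ (2 * m))) (≡.sym (ℤ.pos-* (suc n) (2 * m)))))))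

  a∙a^[2m-1]≈e : a ∙ a ^ ℕ.pred (2 * m) ≈ e
  a∙a^[2m-1]≈e = trans (G.reflexive (≡.cong (a ^_) (ℕ.suc-pred (2 * m)))) (relation a²ᵐ≈e)
    where module G = Group (Q₄ m)

  -- The conjugation relation gives ab = ba⁻¹. The exponent is written 2m - 1 instead of -1 because
  -- normal forms use natural powers of `a`.
  ba≈a^[2m-1]b : b ∙ a ≈ a ^ ℕ.pred (2 * m) ∙ b
  ba≈a^[2m-1]b = begin
    b ∙ a                        ≈⟨ ∙-cong (identityˡ b) refl ⟨
    e ∙ b ∙ a                    ≈⟨ ∙-cong (∙-cong c∙a≈e refl) refl ⟨
    c ∙ a ∙ b ∙ a                ≈⟨ ∙-cong (assoc c a b) refl ⟩
    c ∙ (a ∙ b) ∙ a              ≈⟨ ∙-cong (∙-cong refl ab≈ba⁻¹) refl ⟩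
    c ∙ (b ∙ a ⁻¹) ∙ a           ≈⟨ assoc c (b ∙ a ⁻¹) a ⟩
    c ∙ (b ∙ a ⁻¹ ∙ a)           ≈⟨ ∙-cong refl (assoc b (a ⁻¹) a) ⟩
    c ∙ (b ∙ (a ⁻¹ ∙ a))         ≈⟨ ∙-cong refl (∙-cong refl (inverseˡ a)) ⟩
    c ∙ (b ∙ e)                  ≈⟨ ∙-cong refl (identityʳ b) ⟩
    c ∙ b                        ∎
    where
    c = a ^ ℕ.pred (2 * m)
    ab≈ba⁻¹ : a ∙ b ≈ b ∙ a ⁻¹
    ab≈ba⁻¹ = begin
      a ∙ b                  ≈⟨ identityˡ _ ⟨
      e ∙ (a ∙ b)            ≈⟨ ∙-cong (inverseʳ b) refl ⟨
      b ∙ b ⁻¹ ∙ (a ∙ b)     ≈⟨ assoc b (b ⁻¹) (a ∙ b) ⟩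
      b ∙ (b ⁻¹ ∙ (a ∙ b))   ≈⟨ ∙-cong refl (assoc (b ⁻¹) a b) ⟨
      b ∙ (b ⁻¹ ∙ a ∙ b)     ≈⟨ ∙-cong refl (relation b⁻¹ab≈a⁻¹) ⟩
      b ∙ a ⁻¹               ∎
    a⁻¹≈c : a ⁻¹ ≈ c
    a⁻¹≈c = begin
      a ⁻¹              ≈⟨ identityʳ _ ⟨
      a ⁻¹ ∙ e          ≈⟨ ∙-cong refl a∙a^[2m-1]≈e ⟨
      a ⁻¹ ∙ (a ∙ c)    ≈⟨ assoc (a ⁻¹) a c ⟨
      a ⁻¹ ∙ a ∙ c      ≈⟨ ∙-cong (inverseˡ a) refl ⟩
      e ∙ c             ≈⟨ identityˡ c ⟩
      c                 ∎
    c∙a≈e : c ∙ a ≈ e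
    c∙a≈e = trans (∙-cong (sym a⁻¹≈c) refl) (inverseˡ a)

  b^ᵇ : Bool → Term Generator
  b^ᵇ false = e
  b^ᵇ true  = b

  -- Shifts are integers that matter modulo 2m, while powers of terms have natural exponents.
  -- Leaving `k` free lets exponents be added without reducing them.
  Represents : ℤ → Bool → Term Generator → Set
  Represents i l g = ∃[ k ] i ≋ + k × g ≈ a ^ k ∙ b^ᵇ l

  Represents-unique : ∀ {i j l g h} → i ≋ j → Represents i l g → Represents j l h → g ≈ h
  Represents-unique i≋j (k , i≋k , g≈) (n , j≋n , h≈) = trans g≈
    (trans (∙-cong (a^-cong (≋-trans (≋-sym i≋k) (≋-trans i≋j j≋n))) refl) (sym h≈))

  representative : ∀ i l → Represents i l (a ^ Fin.toℕ (residue i) ∙ b^ᵇ l)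
  representative i l = _ , residue-≋ i , refl

  Represents-∙gen : ∀ x {i l g} → Represents i l g →
                    Represents (i ℤ.+ shift l (gen x)) (l xor parity (gen x)) (g ∙ gen x)
  Represents-∙gen 𝕒 {i} {false} {g} (k , i≋k , g≈) = k ℕ.+ 1 , +-cong i≋k (≋-reflexive ≡.refl) , (begin
    g ∙ a                  ≈⟨ ∙-cong (trans g≈ (identityʳ _)) refl ⟩
    a ^ k ∙ a              ≈⟨ ∙-cong refl (identityʳ a) ⟨
    a ^ k ∙ a ^ 1          ≈⟨ a^-+ k 1 ⟨
    a ^ (k ℕ.+ 1)          ≈⟨ identityʳ _ ⟨
    a ^ (k ℕ.+ 1) ∙ e      ∎)
  Represents-∙gen 𝕒 {i} {true} {g} (k , i≋k , g≈) = k ℕ.+ n , +-cong i≋k -1≋n , (begin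
    g ∙ a                  ≈⟨ ∙-cong g≈ refl ⟩
    a ^ k ∙ b ∙ a          ≈⟨ assoc _ b a ⟩
    a ^ k ∙ (b ∙ a)        ≈⟨ ∙-cong refl ba≈a^[2m-1]b ⟩
    a ^ k ∙ (a ^ n ∙ b)    ≈⟨ assoc _ _ b ⟨
    a ^ k ∙ a ^ n ∙ b      ≈⟨ ∙-cong (a^-+ k n) refl ⟨
    a ^ (k ℕ.+ n) ∙ b      ∎)
    where
    n = ℕ.pred (2 * m)
    -1≋n : -1ℤ ≋ + n
    -1≋n = ≋-sym (congruent (divides 1ℤ (≡.trans (ℤ.+-comm (+ n) 1ℤ)
      (≡.trans (≡.cong +_ (ℕ.suc-pred (2 * m))) (≡.sym (ℤ.*-identityˡ _))))))
  Represents-∙gen 𝕓 {i} {false} {g} (k , i≋k , g≈) =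
    k , ≋-trans (≋-reflexive (ℤ.+-identityʳ i)) i≋k , ∙-cong (trans g≈ (identityʳ _)) refl
  Represents-∙gen 𝕓 {i} {true} {g} (k , i≋k , g≈) = k ℕ.+ m , +-cong i≋k (≋-reflexive ≡.refl) , (begin
    g ∙ b                  ≈⟨ ∙-cong g≈ refl ⟩
    a ^ k ∙ b ∙ b          ≈⟨ assoc _ b b ⟩
    a ^ k ∙ (b ∙ b)        ≈⟨ ∙-cong refl (∙-cong refl (identityʳ b)) ⟨
    a ^ k ∙ b ^ 2          ≈⟨ ∙-cong refl (relation b²≈aᵐ) ⟩
    a ^ k ∙ a ^ m          ≈⟨ a^-+ k m ⟨
    a ^ (k ℕ.+ m)          ≈⟨ identityʳ _ ⟨
    a ^ (k ℕ.+ m) ∙ e      ∎)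

  Represents-cong : ∀ {i j l l′ g} → i ≋ j → l ≡ l′ → Represents i l g → Represents j l′ g
  Represents-cong i≋j ≡.refl (k , i≋k , g≈) = k , ≋-trans (≋-sym i≋j) i≋k , g≈

  Represents-resp : ∀ {i l g h} → g ≈ h → Represents i l g → Represents i l h
  Represents-resp g≈h (k , i≋k , g≈) = k , i≋k , trans (sym g≈h) g≈

  Represents-∙ : ∀ t {i l g} → Represents i l g → Represents (i ℤ.+ shift l t) (l xor parity t) (g ∙ t)
  Represents-∙ (gen x) R = Represents-∙gen x R
  Represents-∙ e {i} {l} {g} R =
    Represents-cong (≋-reflexive (≡.sym (ℤ.+-identityʳ i))) (≡.sym (Bool.xor-identityʳ l))
      (Represents-resp (sym (identityʳ g)) R)
  Represents-∙ (s ∙ t) {i} {l} {g} R =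
    Represents-cong (≋-reflexive (ℤ.+-assoc i _ _)) (Bool.xor-assoc l (parity s) (parity t))
      (Represents-resp (assoc g s t) (Represents-∙ t (Represents-∙ s R)))
  -- No formula for inverting a normal form is used. The expected value `h` of `g ∙ t ⁻¹` is written
  -- down, the induction hypothesis for `t` shows `h ∙ t ≈ g`, and `t` is cancelled.
  Represents-∙ (t ⁻¹) {i} {l} {g} R = Represents-resp h≈g∙t⁻¹ (representative i′ l′)
    where
    l′ = l xor parity t
    i′ = i ℤ.+ - shift l′ t
    h = a ^ Fin.toℕ (residue i′) ∙ b^ᵇ l′
    lemma : ∀ i j → i ℤ.+ - j ℤ.+ j ≡ i
    lemma = solve-∀
    h∙t≈g : h ∙ t ≈ g
    h∙t≈g = Represents-unique (≋-reflexive (lemma i (shift l′ t)))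
      (Represents-cong (≋-reflexive ≡.refl) (xor-cancelʳ l (parity t))
        (Represents-∙ t (representative i′ l′))) R
    h≈g∙t⁻¹ : h ≈ g ∙ t ⁻¹
    h≈g∙t⁻¹ = begin
      h                ≈⟨ identityʳ h ⟨
      h ∙ e            ≈⟨ ∙-cong refl (inverseʳ t) ⟨
      h ∙ (t ∙ t ⁻¹)   ≈⟨ assoc h t (t ⁻¹) ⟨
      h ∙ t ∙ t ⁻¹     ≈⟨ ∙-cong h∙t≈g refl ⟩
      g ∙ t ⁻¹         ∎

  represents : ∀ t → Represents (shift false t) (parity t) t
  represents t = Represents-resp (identityˡ t)
    (Represents-cong (≋-reflexive (ℤ.+-identityˡ _)) ≡.refl
      (Represents-∙ t (0 , ≋-reflexive ≡.refl , sym (identityʳ e))))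

  -- Both terms reduce to normal forms with the same power of `b` and congruent exponents of `a`.
  -- Together with the invariance of `parity` and `shift`, this solves the word problem.
  ≈-complete : ∀ {s t} → parity s ≡ parity t → shift false s ≋ shift false t → s ≈ t
  ≈-complete {s} {t} p q = Represents-unique q
    (Represents-cong (≋-reflexive ≡.refl) p (represents s)) (represents t)

  normalForm : Bool × Fin (2 * m) → Term Generator
  normalForm (l , r) = a ^ Fin.toℕ r ∙ b^ᵇ l

  coordinates : Term Generator → Bool × Fin (2 * m)
  coordinates t = parity t , residue (shift false t)

  coordinates-cong : ∀ {s t} → s ≈ t → coordinates s ≡ coordinates t
  coordinates-cong s≈t = ≡.cong₂ _,_ (parity-cong s≈t)
    (≋⇒≡ (≋-trans (≋-sym (residue-≋ _)) (≋-trans (shift-cong s≈t false) (residue-≋ _))))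

  normalForm-coordinates : ∀ t → normalForm (coordinates t) ≈ t
  normalForm-coordinates t =
    Represents-unique (≋-reflexive ≡.refl) (representative (shift false t) (parity t)) (represents t)

  coordinates-normalForm : ∀ c → coordinates (normalForm c) ≡ c
  coordinates-normalForm (l , r) = ≡.cong₂ _,_ (parity-nf l)
    (≋⇒≡ (≋-trans (≋-sym (residue-≋ _)) (≋-reflexive (shift-nf l))))
    where
    k = Fin.toℕ r
    parity-nf : ∀ l → parity (a ^ k ∙ b^ᵇ l) ≡ l
    parity-nf false rewrite parity-a^ k = ≡.refl
    parity-nf true  rewrite parity-a^ k = ≡.refl
    shift-nf : ∀ l → shift false (a ^ k ∙ b^ᵇ l) ≡ + k
    shift-nf false rewrite shift-a^ k = ℤ.+-identityʳ (+ k)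
    shift-nf true  rewrite parity-a^ k | shift-a^ k = ℤ.+-identityʳ (+ k)

  coordinates-inverse : Inverse (≡.setoid (Bool × Fin (2 * m))) (Group.setoid (Q₄ m))
  coordinates-inverse = record
    { to        = normalForm
    ; from      = coordinates
    ; to-cong   = λ { ≡.refl → refl }
    ; from-cong = coordinates-cong
    ; inverse   = (λ { {t} ≡.refl → normalForm-coordinates t })
                , (λ { {c} t≈ → ≡.trans (coordinates-cong t≈) (coordinates-normalForm c) })
    }

  enumeration : Enumeration (Q₄ m) (4 * m)
  enumeration = ≡.subst (Enumeration (Q₄ m)) (≡.sym (ℕ.*-assoc 2 2 m))
    (Composition.inverse
      (Composition.inverse Fin.*↔× (Fin.2↔Bool ×-↔ Identity.↔-id _)) coordinates-inverse)

-- Symbolic exploration of short words, uniformly in m.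

-- (j , ε , l) stands for a^(j + εm) bˡ, simultaneously for all m.
State : Set
State = ℤ × Bool × Bool

-- Behind a `b`, the letter `a` lowers the exponent and a second `b` adds m to it. Negating `ε`
-- records that addition because a^(2m) = e.
next : State → Generator → State
next (j , ε , false) 𝕒 = j ℤ.+ 1ℤ , ε , false
next (j , ε , true)  𝕒 = j ℤ.+ -1ℤ , ε , true
next (j , ε , false) 𝕓 = j , ε , true
next (j , ε , true)  𝕓 = j , not ε , false

-- Sufficient for s and t to stand for distinct elements for every m ≥ M.
Apart : ℕ → State → State → Set
Apart M (i , ε , l) (j , η , l′) =
  l ≢ l′ ⊎ (ε ≡ η × 0 < ∣ i - j ∣ × ∣ i - j ∣ < 2 * M) ⊎ (ε ≢ η × ∣ i - j ∣ < M)

apart? : ∀ M s t → Dec (Apart M s t)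
apart? M (i , ε , l) (j , η , l′) =
  ¬? (l Bool.≟ l′) ⊎-dec
  (ε Bool.≟ η ×-dec 0 ℕ.<? ∣ i - j ∣ ×-dec ∣ i - j ∣ ℕ.<? 2 * M) ⊎-dec
  (¬? (ε Bool.≟ η) ×-dec ∣ i - j ∣ ℕ.<? M)

Avoids : ℕ → ℕ → State → State → Set
Avoids M zero    s t = Apart M s t
Avoids M (suc n) s t = Avoids M n (next s 𝕒) t × Avoids M n (next s 𝕓) t

avoids? : ∀ M n s t → Dec (Avoids M n s t)
avoids? M zero    s t = apart? M s t
avoids? M (suc n) s t = avoids? M n (next s 𝕒) t ×-dec avoids? M n (next s 𝕓) t

-- The bound is strict: all walks shorter than `k` are excluded, so `Far M 1` says that the two
-- states are apart.
Far : ℕ → ℕ → State → State → Set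
Far M k s t = ∀ n → n < k → Avoids M n s t

far? : ∀ M k s t → Dec (Far M k s t)
far? M k s t = map′ (λ far n → far {n}) (λ far {n} → far n) (ℕ.allUpTo? (λ n → avoids? M n s t) k)

origin : State
origin = 0ℤ , false , false

follow : Term Generator → List Generator → Term Generator
follow = foldl (λ g x → g ∙ gen x)

-- The Cayley graph: distinct elements, walks and distances.

module QuaternionCayley (m : ℕ) .{{_ : NonZero m}} where
  open Congruence (2 * m)
  open Quaternion m

  offset : Bool → ℤ
  offset ε = if ε then + m else 0ℤ

  record At (g : Term Generator) (s : State) : Set where
    constructor at
    field
      parity≡ : parity g ≡ proj₂ (proj₂ s)
      shift≋  : shift false g ≋ proj₁ s ℤ.+ offset (proj₁ (proj₂ s))

  At-resp : ∀ {g h s} → g ≈ h → At g s → At h s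
  At-resp g≈h (at p q) =
    at (≡.trans (≡.sym (parity-cong g≈h)) p) (≋-trans (≋-sym (shift-cong g≈h false)) q)

  At-unique : ∀ {g h s} → At g s → At h s → g ≈ h
  At-unique (at p q) (at p′ q′) = ≈-complete (≡.trans p (≡.sym p′)) (≋-trans q (≋-sym q′))

  At-e : At e origin
  At-e = at ≡.refl (≋-reflexive ≡.refl)

  +-swapʳ : ∀ i j k → i ℤ.+ j ℤ.+ k ≡ i ℤ.+ k ℤ.+ j
  +-swapʳ = solve-∀

  At-next : ∀ x {g} s → At g s → At (g ∙ gen x) (next s x)
  At-next 𝕒 (j , ε , false) (at p q) = at (≡.cong (_xor false) p)
    (≋-trans (+-cong q (≋-reflexive (≡.cong (λ l → shiftᵍ l 𝕒) p)))
      (≋-reflexive (+-swapʳ j (offset ε) 1ℤ)))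
  At-next 𝕒 (j , ε , true) (at p q) = at (≡.cong (_xor false) p)
    (≋-trans (+-cong q (≋-reflexive (≡.cong (λ l → shiftᵍ l 𝕒) p)))
      (≋-reflexive (+-swapʳ j (offset ε) -1ℤ)))
  At-next 𝕓 (j , ε , false) (at p q) = at (≡.cong (_xor true) p)
    (≋-trans (+-cong q (≋-reflexive (≡.cong (λ l → shiftᵍ l 𝕓) p))) (≋-reflexive (ℤ.+-identityʳ _)))
  At-next 𝕓 (j , ε , true) (at p q) = at (≡.cong (_xor true) p)
    (≋-trans (+-cong q (≋-reflexive (≡.cong (λ l → shiftᵍ l 𝕓) p)))
      (≋-trans (≋-reflexive (ℤ.+-assoc j _ _)) (+-cong (≋-reflexive {j} ≡.refl) (offset-not ε))))
    where
    2m≡m+m-0 : ∀ n → 1ℤ ℤ.* (+ 2 ℤ.* n) ≡ n ℤ.+ n - 0ℤ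
    2m≡m+m-0 = solve-∀
    offset-not : ∀ ε → offset ε ℤ.+ + m ≋ offset (not ε)
    offset-not false = ≋-reflexive (ℤ.+-identityˡ (+ m))
    offset-not true  = congruent (divides 1ℤ
      (≡.sym (≡.trans (≡.cong (1ℤ ℤ.*_) (ℤ.pos-* 2 m)) (2m≡m+m-0 (+ m)))))

  At-gen : ∀ x → At (gen x) (next origin x)
  At-gen x = At-resp (identityˡ (gen x)) (At-next x origin At-e)

  At-follow : ∀ w {g s} → At g s → At (follow g w) (foldl next s w)
  At-follow []      p = p
  At-follow (x ∷ w) p = At-follow w (At-next x _ p)

  -- Exchanging `ε` and `η` changes the sign of m, which is invisible modulo 2m, so both mixed cases
  -- give the same congruence.
  offset-differ : ∀ {i j} ε η → ε ≢ η → i ℤ.+ offset ε ≋ j ℤ.+ offset η → i - j ≋ + m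
  offset-differ false false ε≢η _ = contradiction ≡.refl ε≢η
  offset-differ true  true  ε≢η _ = contradiction ≡.refl ε≢η
  offset-differ {i} {j} false true _ i≋j+m =
    ≋-trans (≋-reflexive (≡.cong (_- j) (≡.sym (ℤ.+-identityʳ i))))
      (≋-trans (+-cong i≋j+m (≋-reflexive ≡.refl)) (≋-reflexive (cancel j (+ m))))
    where
    cancel : ∀ j k → j ℤ.+ k - j ≡ k
    cancel = solve-∀
  offset-differ {i} {j} true false _ i+m≋j =
    ≋-trans (≋-sym (+N≋ (i - j))) (≋-trans (≋-reflexive {j = (i ℤ.+ + m) ℤ.+ (+ m - j)} (≡.trans
      (≡.cong (λ x → i - j ℤ.+ x) (ℤ.pos-* 2 m)) (double i j (+ m))))
      (≋-trans (+-cong i+m≋j (≋-reflexive ≡.refl)) (≋-reflexive (cancel j (+ m)))))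
    where
    double : ∀ i j k → i - j ℤ.+ (+ 2 ℤ.* k) ≡ (i ℤ.+ k) ℤ.+ (k - j)
    double = solve-∀
    cancel : ∀ j k → (j ℤ.+ 0ℤ) ℤ.+ (k - j) ≡ k
    cancel = solve-∀

  ∣i∣<m⇒i≢m : ∀ {i} → ∣ i ∣ < m → ¬ (i ≋ + m)
  ∣i∣<m⇒i≢m {i} ∣i∣<m (congruent N∣i-m) = ℕ.<-irrefl ≡.refl
    -- Since |i - m| < 2m, the congruence forces i = m, against |i| < m.
    (≡.subst (λ j → ∣ j ∣ < m) (ℤ.i-j≡0⇒i≡j i (+ m) (∣i∣<N⇒i≡0 N∣i-m (begin-strict
      ∣ i - + m ∣      ≤⟨ ℤ.∣i-j∣≤∣i∣+∣j∣ i (+ m) ⟩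
      ∣ i ∣ ℕ.+ m      <⟨ ℕ.+-monoˡ-< m ∣i∣<m ⟩
      m ℕ.+ m          ≡⟨ ≡.cong (m ℕ.+_) (ℕ.+-identityʳ m) ⟨
      2 * m            ∎))) ∣i∣<m)
    where open ℕ.≤-Reasoning

  -- Parity is an invariant. With equal `ε` the offsets cancel, and `i - j` would be a nonzero
  -- multiple of 2m of absolute value below 2m. With different `ε` it would be congruent to m while
  -- smaller than m in absolute value.
  apart⇒≉ : ∀ {M} → M ≤ m → ∀ {g h} s t → At g s → At h t → Apart M s t → ¬ g ≈ h
  apart⇒≉ M≤m s t (at p _) (at q _) (inj₁ l≢l′) g≈h =
    l≢l′ (≡.trans (≡.sym p) (≡.trans (parity-cong g≈h) q))
  apart⇒≉ M≤m (i , ε , _) (j , _ , _) (at _ p) (at _ q) (inj₂ (inj₁ (≡.refl , 0<∣i-j∣ , ∣i-j∣<2M))) g≈h =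
    ℕ.<⇒≢ 0<∣i-j∣ (≡.sym (≡.cong ∣_∣ (∣i∣<N⇒i≡0 N∣i-j (ℕ.<-≤-trans ∣i-j∣<2M (ℕ.*-monoʳ-≤ 2 M≤m)))))
    where
    cancel : ∀ i j k → (i ℤ.+ k) - (j ℤ.+ k) ≡ i - j
    cancel = solve-∀
    N∣i-j : + (2 * m) ∣ℤ i - j
    N∣i-j = ≡.subst (+ (2 * m) ∣ℤ_) (cancel i j (offset ε))
      (_≋_.N∣i-j (≋-trans (≋-sym p) (≋-trans (shift-cong g≈h false) q)))
  apart⇒≉ M≤m (i , ε , _) (j , η , _) (at _ p) (at _ q) (inj₂ (inj₂ (ε≢η , ∣i-j∣<M))) g≈h =
    ∣i∣<m⇒i≢m (ℕ.<-≤-trans ∣i-j∣<M M≤m)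
      (offset-differ {i} {j} ε η ε≢η (≋-trans (≋-sym p) (≋-trans (shift-cong g≈h false) q)))

  e∉S : All (λ s → ¬ s ≈ e) (a ∷ b ∷ [])
  e∉S = apart⇒≉ {1} 0<m (1ℤ , false , false) _ (at ≡.refl (≋-reflexive ≡.refl)) At-e
          (inj₂ (inj₁ (≡.refl , ℕ.s≤s ℕ.z≤n , ℕ.s≤s (ℕ.s≤s ℕ.z≤n))))
      ∷ (λ b≈e → contradiction (parity-cong b≈e) λ ())
      ∷ []
    where
    0<m : 0 < m
    0<m = ℕ.>-nonZero⁻¹ m

  Γ : FiniteDigraph _ _ _
  Γ = Cayley (Q₄ m) enumeration (a ∷ b ∷ []) e∉S

  open FiniteDigraph Γ using (Arc; Walk; stop; step; Distance)
  open Digraphs Γ using (Walk-respʳ; _++_; distance)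

  arc : ∀ x {g h} → h ≈ g ∙ gen x → Arc g h
  arc 𝕒 h≈ga = here h≈ga
  arc 𝕓 h≈gb = there (here h≈gb)

  walk : ∀ g w → Walk (length w) g (follow g w)
  walk g []      = stop refl
  walk g (x ∷ w) = step (arc x refl) (walk (g ∙ gen x) w)

  walk-a^ : ∀ g k → Walk k g (g ∙ a ^ k)
  walk-a^ g zero    = stop (sym (identityʳ g))
  walk-a^ g (suc k) = step (arc 𝕒 refl) (Walk-respʳ (assoc g a (a ^ k)) (walk-a^ (g ∙ a) k))

  walk-b^ᵇ : ∀ g l → ∃[ n ] Walk n g (g ∙ b^ᵇ l)
  walk-b^ᵇ g false = 0 , stop (sym (identityʳ g))
  walk-b^ᵇ g true  = 1 , walk g (𝕓 ∷ [])

  -- A normal form contains no inverses, so the one of g⁻¹h spells a directed walk from `g` to `h`.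
  connected : ∀ g h → ∃[ n ] Walk n g h
  connected g h = _ , Walk-respʳ ends-at-h
    (walk-a^ g k ++ proj₂ (walk-b^ᵇ (g ∙ a ^ k) (parity t)))
    where
    open SetoidReasoning (Group.setoid (Q₄ m))
    t = g ⁻¹ ∙ h
    k = Fin.toℕ (residue (shift false t))
    ends-at-h : g ∙ a ^ k ∙ b^ᵇ (parity t) ≈ h
    ends-at-h = begin
      g ∙ a ^ k ∙ b^ᵇ (parity t)    ≈⟨ assoc _ _ _ ⟩
      g ∙ normalForm (coordinates t) ≈⟨ ∙-cong refl (normalForm-coordinates t) ⟩
      g ∙ (g ⁻¹ ∙ h)                ≈⟨ assoc g (g ⁻¹) h ⟨
      g ∙ g ⁻¹ ∙ h                  ≈⟨ ∙-cong (inverseʳ g) refl ⟩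
      e ∙ h                         ≈⟨ identityˡ h ⟩
      h                             ∎

  δ : Distance
  δ = distance connected

  open Distance δ

  d≤length : ∀ {g h} w → follow g w ≈ h → d g h ≤ length w
  d≤length {g} w w≈h = shortest (Walk-respʳ w≈h (walk g w))

  module _ {M} (M≤m : M ≤ m) where

    avoids⇒¬walk : ∀ {n g h} s t → At g s → At h t → Avoids M n s t → ¬ Walk n g h
    avoids⇒¬walk s t g-s h-t apart (stop g≈h) = apart⇒≉ M≤m s t g-s h-t apart g≈h
    avoids⇒¬walk s t g-s h-t (avoids , _) (step (here k≈ga) p) =
      avoids⇒¬walk _ t (At-resp (sym k≈ga) (At-next 𝕒 s g-s)) h-t avoids p
    avoids⇒¬walk s t g-s h-t (_ , avoids) (step (there (here k≈gb)) p) =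
      avoids⇒¬walk _ t (At-resp (sym k≈gb) (At-next 𝕓 s g-s)) h-t avoids p

    far⇒≤d : ∀ {k g h} s t → At g s → At h t → Far M k s t → k ≤ d g h
    far⇒≤d s t g-s h-t far = ℕ.≮⇒≥ λ d<k → avoids⇒¬walk s t g-s h-t (far _ d<k) (attained _ _)

    far⇒≉ : ∀ {g h} s t → At g s → At h t → Far M 1 s t → ¬ g ≈ h
    far⇒≉ s t g-s h-t far = apart⇒≉ M≤m s t g-s h-t (far 0 (ℕ.s≤s ℕ.z≤n))

-- Curvature of the two arcs.

data GeneratorPair : Generator → Generator → Set where
  𝕒𝕓 : GeneratorPair 𝕒 𝕓
  𝕓𝕒 : GeneratorPair 𝕓 𝕒

-- Here `k` is c - 2, so `M` is c, which never exceeds m. `P` and `Q` are xy and x². The fields are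
-- the lower bounds on distances that optimality requires, together with the distinctness of the
-- out-neighbours.
record Separated (k : ℕ) (x y : Generator) : Set where
  M = 2 ℕ.+ k
  X = next origin x
  Y = next origin y
  P = next X y
  Q = next X x
  field
    oX : Far M 1 origin X
    XY : Far M 1 X Y
    PQ : Far M 1 P Q
    oP : Far M 2 origin P
    oQ : Far M 2 origin Q
    XP : Far M 1 X P
    XQ : Far M 1 X Q
    YX : Far M k Y X
    YP : Far M (suc k) Y P
    YQ : Far M (suc k) Y Q

separated? : ∀ k x y → Dec (Separated k x y)
separated? k x y = map′
  (λ { (oX , XY , PQ , oP , oQ , XP , XQ , YX , YP , YQ) → record
    { oX = oX ; XY = XY ; PQ = PQ ; oP = oP ; oQ = oQ
    ; XP = XP ; XQ = XQ ; YX = YX ; YP = YP ; YQ = YQ } })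
  (λ sep → let open Separated sep in oX , XY , PQ , oP , oQ , XP , XQ , YX , YP , YQ)
  (far? M 1 origin X ×-dec far? M 1 X Y ×-dec far? M 1 P Q ×-dec
   far? M 2 origin P ×-dec far? M 2 origin Q ×-dec far? M 1 X P ×-dec far? M 1 X Q ×-dec
   far? M k Y X ×-dec far? M (suc k) Y P ×-dec far? M (suc k) Y Q)
  where
  M = 2 ℕ.+ k
  X = next origin x
  Y = next origin y
  P = next X y
  Q = next X x

-- For closed arguments the hidden proof is supplied by running the decision procedure. One run with
-- `M = 2 + k` settles every m ≥ M.
separated : ∀ k x y → {True (separated? k x y)} → Separated k x y
separated k x y {yes-separated} = toWitness yes-separated

module _ {c ℓ₁ ℓ₂ ℓ₃} (ℝ : RealNumbers c ℓ₁ ℓ₂ ℓ₃) where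
  open RealNumbers ℝ using (fromℕ) renaming (Carrier to R; _≈_ to _≈ᴿ_; _+_ to _+ᴿ_)
  open Reals ℝ using (0+0+2≈2; n+n≈2n; x/2+x/2≈x; negated-half)

  -- W(μ_e, μ_x) = α + (2 + k)β.
  record Detour (m : ℕ) .{{_ : NonZero m}} (x y : Generator) (κ : R) : Set (c ⊔ ℓ₁) where
    field
      k         : ℕ
      2+k≤m     : 2 ℕ.+ k ≤ m
      1+k≤5     : suc k ≤ 5
      word      : List Generator
      ∣word∣≡   : length word ≡ suc k
      word-≈    : Quaternion._≈_ m (follow (gen y) word) (gen x ∙ gen x)
      separate  : Separated k x y
      κ+κ≈      : κ +ᴿ κ +ᴿ fromℕ (2 ℕ.+ k) ≈ᴿ fromℕ 2

  arc-curvature : ∀ m .{{_ : NonZero m}} {x y κ} → GeneratorPair x y → Detour m x y κ →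
    HasCurvature ℝ (QuaternionCayley.Γ m) e (gen x) κ
  arc-curvature m {x} {y} {κ} swap detour =
    δ , far⇒≉ M≤m origin X At-e At-X oX , limitCurvature κ+κ≈ (far⇒≉ M≤m origin X At-e At-X oX)
    where
    open Detour detour renaming (2+k≤m to M≤m)
    open Separated separate
    open QuaternionCayley m
    open Quaternion m
    open Digraphs Γ using (OutNeighbours)
    At-X = At-gen x
    At-Y = At-gen y
    At-P = At-next y X At-X
    At-Q = At-next x X At-X

    only : ∀ {g p q h} → GeneratorPair x y → p ≈ g ∙ gen x → q ≈ g ∙ gen y →
           FiniteDigraph.Arc Γ g h → p ≈ h ⊎ q ≈ h
    only 𝕒𝕓 p≈ q≈ (here h≈)         = inj₁ (trans p≈ (sym h≈))
    only 𝕒𝕓 p≈ q≈ (there (here h≈)) = inj₂ (trans q≈ (sym h≈))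
    only 𝕓𝕒 p≈ q≈ (here h≈)         = inj₂ (trans q≈ (sym h≈))
    only 𝕓𝕒 p≈ q≈ (there (here h≈)) = inj₁ (trans p≈ (sym h≈))

    N-e : OutNeighbours e (gen x) (gen y)
    N-e = record
      { left     = arc x (sym (identityˡ (gen x)))
      ; right    = arc y (sym (identityˡ (gen y)))
      ; distinct = far⇒≉ M≤m X Y At-X At-Y XY
      ; only     = only swap (sym (identityˡ (gen x))) (sym (identityˡ (gen y)))
      }

    N-x : OutNeighbours (gen x) (gen x ∙ gen y) (gen x ∙ gen x)
    N-x = record
      { left     = arc y refl
      ; right    = arc x refl
      ; distinct = far⇒≉ M≤m P Q At-P At-Q PQ
      -- The neighbour xy is listed before x² because the plan sends x to xy and y to x².
      ; only     = Sum.swap ∘ only swap refl refl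
      }

    open Transport ℝ Γ
    open Optimal δ N-e N-x 1+k≤5
      (ℕ.≤-antisym (d≤length (x ∷ []) (identityˡ (gen x))) (far⇒≤d M≤m origin X At-e At-X oX))
      (ℕ.≤-antisym (d≤length (y ∷ []) refl) (far⇒≤d M≤m X P At-X At-P XP))
      (ℕ.≤-antisym (ℕ.≤-trans (d≤length word word-≈) (ℕ.≤-reflexive ∣word∣≡))
        (far⇒≤d M≤m Y Q At-Y At-Q YQ))
      (far⇒≤d M≤m origin P At-e At-P oP)
      (far⇒≤d M≤m origin Q At-e At-Q oQ)
      (far⇒≤d M≤m X Q At-X At-Q XQ)
      (ℕ.s≤s (far⇒≤d M≤m Y X At-Y At-X YX))
      (far⇒≤d M≤m Y P At-Y At-P YP)

  -- There are two routes from b to a². Since a^(m-2) b = b a^(2-m), the product b a^(m-2) b equals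
  -- a^2, a route of length m - 1. Since b² = a^m squares to e and commutes with a, also b² a² b² =
  -- a², a route of length 5, which is taken from m = 6 on.
  detour-a : ∀ m .{{_ : NonZero m}} → 2 ≤ m → Detour m 𝕒 𝕓 (curvature-ea ℝ m)
  detour-a 1 (ℕ.s≤s ())
  detour-a 2 _ = record
    { k = 0 ; 2+k≤m = ℕ.m≤m+n 2 _ ; 1+k≤5 = ℕ.m≤m+n 1 _
    ; word = 𝕓 ∷ [] ; ∣word∣≡ = ≡.refl
    -- This route ends in a symbolic state different from that of a². The endpoints agree only
    -- because of the value of m, so concrete shifts are compared.
    ; word-≈ = Quaternion.≈-complete 2 ≡.refl (Congruence.≋-reflexive _ ≡.refl)
    ; separate = separated 0 𝕒 𝕓 ; κ+κ≈ = 0+0+2≈2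
    }
  detour-a 3 _ = record
    { k = 1 ; 2+k≤m = ℕ.m≤m+n 3 _ ; 1+k≤5 = ℕ.m≤m+n 2 _
    ; word = 𝕒 ∷ 𝕓 ∷ [] ; ∣word∣≡ = ≡.refl
    ; word-≈ = Quaternion.≈-complete 3 ≡.refl (Congruence.≋-reflexive _ ≡.refl)
    ; separate = separated 1 𝕒 𝕓 ; κ+κ≈ = negated-half 1 (x/2+x/2≈x (fromℕ 1))
    }
  detour-a 4 _ = record
    { k = 2 ; 2+k≤m = ℕ.m≤m+n 4 _ ; 1+k≤5 = ℕ.m≤m+n 3 _
    ; word = 𝕒 ∷ 𝕒 ∷ 𝕓 ∷ [] ; ∣word∣≡ = ≡.refl
    ; word-≈ = Quaternion.≈-complete 4 ≡.refl (Congruence.≋-reflexive _ ≡.refl)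
    ; separate = separated 2 𝕒 𝕓 ; κ+κ≈ = negated-half 2 (n+n≈2n 1)
    }
  detour-a 5 _ = record
    { k = 3 ; 2+k≤m = ℕ.m≤m+n 5 _ ; 1+k≤5 = ℕ.m≤m+n 4 _
    ; word = 𝕒 ∷ 𝕒 ∷ 𝕒 ∷ 𝕓 ∷ [] ; ∣word∣≡ = ≡.refl
    ; word-≈ = Quaternion.≈-complete 5 ≡.refl (Congruence.≋-reflexive _ ≡.refl)
    ; separate = separated 3 𝕒 𝕓 ; κ+κ≈ = negated-half 3 (x/2+x/2≈x (fromℕ 3))
    }
  detour-a m@(suc (suc (suc (suc (suc (suc n)))))) _ = record
    { k = 4 ; 2+k≤m = ℕ.m≤m+n 6 n ; 1+k≤5 = ℕ.m≤m+n 5 _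
    ; word = w ; ∣word∣≡ = ≡.refl
    -- Here m is a variable, but both endpoints carry the same symbolic state: the two passages
    -- through b² flip `ε` twice.
    ; word-≈ = At-unique (At-follow w (At-gen 𝕓)) (At-next 𝕒 _ (At-gen 𝕒))
    ; separate = separated 4 𝕒 𝕓 ; κ+κ≈ = negated-half 4 (n+n≈2n 2)
    }
    where
    open QuaternionCayley m
    w = 𝕓 ∷ 𝕒 ∷ 𝕒 ∷ 𝕓 ∷ 𝕓 ∷ []

  -- From a to b² = a^m one can append a^(m-1), or use bab = a⁻¹b², which gives a(bab) = b² with
  -- three letters. The second route is taken from m = 4 on.
  detour-b : ∀ m .{{_ : NonZero m}} → 2 ≤ m → Detour m 𝕓 𝕒 (curvature-eb ℝ m)
  detour-b 1 (ℕ.s≤s ())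
  detour-b 2 _ = record
    { k = 0 ; 2+k≤m = ℕ.m≤m+n 2 _ ; 1+k≤5 = ℕ.m≤m+n 1 _
    ; word = 𝕒 ∷ [] ; ∣word∣≡ = ≡.refl
    ; word-≈ = Quaternion.≈-complete 2 ≡.refl (Congruence.≋-reflexive _ ≡.refl)
    ; separate = separated 0 𝕓 𝕒 ; κ+κ≈ = 0+0+2≈2
    }
  detour-b 3 _ = record
    { k = 1 ; 2+k≤m = ℕ.m≤m+n 3 _ ; 1+k≤5 = ℕ.m≤m+n 2 _
    ; word = 𝕒 ∷ 𝕒 ∷ [] ; ∣word∣≡ = ≡.refl
    ; word-≈ = Quaternion.≈-complete 3 ≡.refl (Congruence.≋-reflexive _ ≡.refl)
    ; separate = separated 1 𝕓 𝕒 ; κ+κ≈ = negated-half 1 (x/2+x/2≈x (fromℕ 1))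
    }
  detour-b m@(suc (suc (suc (suc n)))) _ = record
    { k = 2 ; 2+k≤m = ℕ.m≤m+n 4 n ; 1+k≤5 = ℕ.m≤m+n 3 _
    ; word = w ; ∣word∣≡ = ≡.refl
    ; word-≈ = At-unique (At-follow w (At-gen 𝕒)) (At-next 𝕓 _ (At-gen 𝕓))
    ; separate = separated 2 𝕓 𝕒 ; κ+κ≈ = negated-half 2 (n+n≈2n 1)
    }
    where
    open QuaternionCayley m
    w = 𝕓 ∷ 𝕒 ∷ 𝕓 ∷ []

proposition4p2 : ∀ {c ℓ₁ ℓ₂ ℓ₃ : Level} (ℝ : RealNumbers c ℓ₁ ℓ₂ ℓ₃) (m : ℕ) → 2 ≤ m →
    Σ[ enum ∈ Enumeration (Q₄ m) (4 * m) ]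
    Σ[ e∉S ∈ All (λ s → ¬ (Group._≈_ (Q₄ m) s e)) (a ∷ b ∷ []) ]
    HasCurvature ℝ (Cayley (Q₄ m) enum (a ∷ b ∷ []) e∉S) e a (curvature-ea ℝ m) ×
    HasCurvature ℝ (Cayley (Q₄ m) enum (a ∷ b ∷ []) e∉S) e b (curvature-eb ℝ m)
proposition4p2 ℝ m 2≤m =
  Quaternion.enumeration m , QuaternionCayley.e∉S m ,
  arc-curvature ℝ m 𝕒𝕓 (detour-a ℝ m 2≤m) , arc-curvature ℝ m 𝕓𝕒 (detour-b ℝ m 2≤m)
  where
  instance
    m≢0 : NonZero m
    m≢0 = ℕ.>-nonZero (ℕ.<-trans (ℕ.s≤s ℕ.z≤n) 2≤m)
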